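{- The polynomials that are both key polynomials and Young key polynomials are exactly the Schur polynomials.
   Context: Fix $n$ and consider weak compositions of length $n$. The key polynomial (Demazure character) is $\kappa_a=\pi_{w_a}x^{\mathrm{sort}(a)}$, where $\pi_i f=\partial_i(x_if)$, $\partial_i f=(f-s_if)/(x_i-x_{i+1})$, $\mathrm{sort}(a)$ is the weakly decreasing rearrangement of $a$, and $w_a$ the minimal length permutation sending $a$ to $\mathrm{sort}(a)$. The Young key polynomial is $\hat\kappa_a(x_1,\ldots,x_n)=\kappa_{\mathrm{rev}(a)}(x_n,\ldots,x_1)$, where $\mathrm{rev}(a)$ is $a$ reversed. Schur polynomials means $s_\lambda(x_1,\ldots,x_n)$. -}

module Defs where

open import Data.Nat as ℕ using (ℕ; zero; suc; _≤_; _<?_; _∸_)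
open import Data.Integer as ℤ using (ℤ; 0ℤ; 1ℤ; _+_; _-_)
open import Data.Fin using (Fin; inject₁; toℕ)
open import Data.Fin.Base using () renaming (suc to fsuc)
open import Data.Vec using (Vec; []; _∷_; lookup; _[_]≔_; reverse; allFin; toList)
open import Data.Vec.Properties using (≡-dec)
open import Data.List as L using (List; []; _∷_; _++_; foldr; upTo; filter; concatMap)
open import Data.Unit using (⊤)
open import Data.Product using (_×_)
open import Relation.Nullary using (yes; no)
open import Relation.Binary.PropositionalEquality using (_≡_)

-- Polynomials in x₁,…,xₙ with integer coefficients, represented by their
-- coefficient function: exponent vector ↦ coefficient.  Equality of
-- polynomials is equality of all coefficients.

Poly : ℕ → Set
Poly n = Vec ℕ n → ℤ

_≈_ : ∀ {n} → Poly n → Poly n → Set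
f ≈ g = ∀ b → f b ≡ g b

infix 4 _≈_

mono : ∀ {n} → Vec ℕ n → Poly n
mono c b with ≡-dec ℕ._≟_ c b
... | yes _ = 1ℤ
... | no  _ = 0ℤ

sumℤ : List ℤ → ℤ
sumℤ = foldr _+_ 0ℤ

mulX : ∀ {n} → Fin n → Poly n → Poly n
mulX j f b with lookup b j
... | zero  = 0ℤ
... | suc e = f (b [ j ]≔ e)

set2 : ∀ {m} → Fin m → Vec ℕ (suc m) → ℕ → ℕ → Vec ℕ (suc m)
set2 i b u v = (b [ inject₁ i ]≔ u) [ fsuc i ]≔ v

-- Divided difference ∂_i f = (f - s_i f)/(x_i - x_{i+1}), computed as the
-- exact quotient.  In the variables x = x_i, y = x_{i+1} (other exponents
-- fixed) write h = f - s_i f; if (x - y) g = h with g = Σ c_k x^{d-1-k} y^k,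
-- then c_k = Σ_{j=0}^{k} [x^{d-j} y^j] h.  Here h has coefficient
-- f(..,d-j,j,..) - f(..,j,d-j,..) at x^{d-j}y^j (s_i swaps x_i and x_{i+1}).
∂ : ∀ {m} → Fin m → Poly (suc m) → Poly (suc m)
∂ i f b =
  let p = lookup b (inject₁ i)
      q = lookup b (fsuc i)
      d = suc (p ℕ.+ q)
  in sumℤ (L.map (λ j → f (set2 i b (d ∸ j) j) - f (set2 i b j (d ∸ j)))
                 (upTo (suc q)))

π : ∀ {m} → Fin m → Poly (suc m) → Poly (suc m)
π i f = ∂ i (mulX (inject₁ i) f)

πword : ∀ {m} → List (Fin m) → Poly (suc m) → Poly (suc m)
πword w f = foldr π f w

insert : ∀ {n} → ℕ → Vec ℕ n → Vec ℕ (suc n)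
insert x [] = x ∷ []
insert x (y ∷ ys) with x <? y
... | yes _ = y ∷ insert x ys
... | no  _ = x ∷ y ∷ ys

sort : ∀ {n} → Vec ℕ n → Vec ℕ n
sort [] = []
sort (x ∷ xs) = insert x (sort xs)

countGt : ∀ {n} → ℕ → Vec ℕ n → ℕ
countGt x [] = 0
countGt x (y ∷ ys) with x <? y
... | yes _ = suc (countGt x ys)
... | no  _ = countGt x ys

-- A reduced word for w_a, the minimal length permutation sending a to
-- sort(a) (0-based: letter i stands for s_{i+1}).  For a = a₁ ∷ a':
-- first a₁ is moved right past the k entries of sort(a') strictly larger
-- than a₁ (letters s₁ ⋯ s_k), then a' is sorted recursively on positions
-- 2..n.  π_{w_a} = π_{word a} (π_w is independent of the reduced word).
word : ∀ {m} → Vec ℕ (suc m) → List (Fin m)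
word (x ∷ []) = []
word {suc m} (x ∷ y ∷ r) =
  L.map fsuc (word (y ∷ r)) ++
  filter (λ j → toℕ j <? countGt x (y ∷ r)) (toList (allFin (suc m)))

κ : ∀ {n} → Vec ℕ n → Poly n
κ {zero}  a = mono a
κ {suc m} a = πword (word a) (mono (sort a))

κ̂ : ∀ {n} → Vec ℕ n → Poly n
κ̂ a b = κ (reverse a) (reverse b)

-- Partitions with at most n parts: weakly decreasing vectors

Decreasing : ∀ {n} → Vec ℕ n → Set
Decreasing [] = ⊤
Decreasing (x ∷ []) = ⊤
Decreasing (x ∷ y ∷ r) = y ≤ x × Decreasing (y ∷ r)

-- Schur polynomial s_λ(x₁,…,xₙ) = Σ_{T ∈ SSYT(λ), entries ≤ n} x^T.
-- A SSYT with entries ≤ n is encoded by its chain of shapes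
-- (entries ≤ k form a partition μ^{(k)} with at most k parts, and
-- μ^{(k)}/μ^{(k-1)} is a horizontal strip, i.e. μ^{(k-1)} interlaces μ^{(k)}),
-- so s_λ(x₁,…,xₙ) = Σ_{μ interlacing λ} s_μ(x₁,…,x_{n-1}) xₙ^{|λ|-|μ|}.

range : ℕ → ℕ → List ℕ
range lo hi = L.map (lo ℕ.+_) (upTo (suc hi ∸ lo))

interlacers : ∀ {m} → Vec ℕ (suc m) → List (Vec ℕ m)
interlacers (x ∷ []) = [] ∷ []
interlacers (x ∷ y ∷ r) =
  concatMap (λ u → L.map (u ∷_) (interlacers (y ∷ r))) (range y x)

vsum : ∀ {n} → Vec ℕ n → ℕ
vsum [] = 0
vsum (x ∷ xs) = x ℕ.+ vsum xs

initLast : ∀ {m} → Vec ℕ (suc m) → Vec ℕ m × ℕ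
initLast (x ∷ []) = [] Data.Product., x
initLast (x ∷ y ∷ r) with initLast (y ∷ r)
... | (i Data.Product., l) = (x ∷ i) Data.Product., l

schur : ∀ {n} → Vec ℕ n → Poly n
schur {zero} λ' b = 1ℤ
schur {suc m} λ' b with initLast b
... | (b' Data.Product., e) =
  sumℤ (L.map (λ μ → coef μ) (interlacers λ'))
  where
  coef : Vec ℕ m → ℤ
  coef μ with vsum λ' ℕ.≟ (vsum μ ℕ.+ e)
  ... | yes _ = schur μ b'
  ... | no  _ = 0ℤ

{-# OPTIONS --safe #-}

-- Schur polynomials are the key polynomials of increasing vectors.  Indeed
-- s_{p∷μ} = π_{k-1} ⋯ π_0 (x₀ᵖ s_μ(x₁, x₂, …)), by induction on the number of
-- variables, splitting off the last one: the operator applied last sees three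
-- consecutive rows of a Gelfand–Tsetlin pattern, and frees the first entry of
-- the middle row, which so far was pinned to p.  As s_λ is symmetric, it is
-- also a Young key polynomial.
--
-- Conversely, the support of κ_a contains sort a, is dominated by it, and has
-- a as its lexicographic minimum.  If κ_a(x) = κ_b(x reversed), then dominance
-- in both directions makes a and b rearrangements of each other, so the
-- increasing rearrangement of a lies in the support of κ_a.  Being the least
-- of all rearrangements, it is the lexicographic minimum a itself.
module Submission where

open import Defs
open import Data.Nat as ℕ using (ℕ; zero; suc; _≤_; _<_; _∸_; z≤n; s≤s; _<?_)
import Data.Nat.Properties as ℕₚ
open import Data.Integer using (ℤ; -[1+_]; 0ℤ; 1ℤ; _+_; _-_; -_) renaming (+_ to pos)
import Data.Integer.Properties as ℤₚ
open import Data.Integer.Tactic.RingSolver using (solve-∀)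
open import Algebra.Properties.CommutativeSemigroup ℕₚ.+-commutativeSemigroup using (interchange; x∙yz≈y∙xz)
import Algebra.Properties.AbelianGroup ℤₚ.+-0-abelianGroup as ℤ+
open import Data.Fin using (Fin; zero; suc; inject₁; fromℕ; toℕ)
open import Data.Vec as V using (Vec; []; _∷_; _∷ʳ_; lookup; reverse; toList; allFin)
import Data.Vec.Properties as Vₚ
open import Data.Vec.Relation.Unary.All as All using (All; []; _∷_)
open import Data.List as L using (List; []; _∷_; _++_; upTo)
import Data.List.Properties as Lₚ
open import Data.List.Relation.Unary.All as LAll using ([]; _∷_)
import Data.List.Relation.Unary.All.Properties as LAllₚ
open import Data.Product using (_×_; _,_; ∃; proj₁; proj₂)
open import Data.Sum using (_⊎_; inj₁; inj₂)
open import Data.Unit using (⊤)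
open import Data.Empty using (⊥)
open import Data.Bool using (true; false)
open import Function using (_∘_; id)
open import Relation.Nullary using (Dec; yes; no; does; contradiction)
open import Relation.Binary using (tri<; tri≈; tri>)
open import Relation.Binary.PropositionalEquality

-- `schur` branches on the last variable and `word` on the first entry, so one of the two recursions
-- has to be turned around. Branching on the last variable is kept, since in a chain of operators
-- only the letter applied last can touch that variable; the words are rearranged instead, in
-- `word-∷ʳ`. Equal parts are a second obstacle. `word` never exchanges equal entries, so the chain
-- that carries p past μ has one letter less for each part of μ equal to p. What these letters would
-- achieve is already forced: equal neighbours in one row pin the entry between them in the next.
-- `Ties` keeps count. Dominance is tested by the sums of max(x - t, 0) over the entries x, for
-- every t, instead of partial sums of a sorted vector. These sums are blind to order, and a
-- Demazure operator controls them by the convexity of a single function.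

private variable
  m n : ℕ
  I K S S′ : Set

-- Isobaric divided differences in two variables

infix 4 _≐_
_≐_ : (I → ℤ) → (I → ℤ) → Set
g ≐ h = ∀ i → g i ≡ h i

infixl 6 _⊕_
_⊕_ : (I → ℤ) → (I → ℤ) → I → ℤ
(g ⊕ h) i = g i + h i

Biv : Set
Biv = ℕ × ℕ → ℤ

X Y : Biv → Biv
X g (zero  , v) = 0ℤ
X g (suc u , v) = g (u , v)
Y g (u , zero)  = 0ℤ
Y g (u , suc v) = g (u , v)

Sym : Biv → Set
Sym g = ∀ u v → g (u , v) ≡ g (v , u)

-- The isobaric divided difference in two variables, from
-- π₂-coeff g p q = Σ_{j ≤ q} g (p + q - j , j) - Σ_{j < q} g (j , p + q - j)
-- by recursion on q along the antidiagonal.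
π₂-coeff : Biv → ℕ → ℕ → ℤ
π₂-coeff g p zero    = g (p , zero)
π₂-coeff g p (suc q) = π₂-coeff g (suc p) q + g (p , suc q) - g (q , suc p)

π₂ : Biv → Biv
π₂ g (p , q) = π₂-coeff g p q

π₂-cong : ∀ {g h} → g ≐ h → ∀ p q → π₂ g (p , q) ≡ π₂ h (p , q)
π₂-cong e p zero    = e _
π₂-cong e p (suc q) = cong₂ _-_ (cong₂ _+_ (π₂-cong e (suc p) q) (e _)) (e _)

π₂-⊕ : ∀ g h p q → π₂ (g ⊕ h) (p , q) ≡ π₂ g (p , q) + π₂ h (p , q)
π₂-⊕ g h p zero  = refl
π₂-⊕ g h p (suc q) rewrite π₂-⊕ g h (suc p) q =
  lem (π₂ g (suc p , q)) _ _ _ _ _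
  where
  lem : ∀ a b c d e f → a + b + (c + d) - (e + f) ≡ a + c - e + (b + d - f)
  lem = solve-∀

π₂-Sym : ∀ {g} → Sym g → ∀ p q → π₂ g (p , q) ≡ g (p , q)
π₂-Sym s p zero = refl
π₂-Sym {g} s p (suc q) rewrite π₂-Sym s (suc p) q | s q (suc p) = lem (g (suc p , q)) _
  where
  lem : ∀ a b → a + b - a ≡ b
  lem = solve-∀

-- The twisted Leibniz rule ∂(x h) = h + y ∂h, taken at h = x g.
π₂-X : ∀ g p q → π₂ (X g) (p , q) ≡ X g (p , q) + Y (π₂ g) (p , q)
π₂-X g p zero = sym (ℤₚ.+-identityʳ _)
π₂-X g p (suc zero) = lem (g (p , 0)) (X g (p , 1))
  where
  lem : ∀ a b → a + b - 0ℤ ≡ b + a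
  lem = solve-∀
π₂-X g p (suc (suc q)) rewrite π₂-X g (suc p) (suc q) =
  lem (g (p , suc q)) (π₂ g (suc p , q)) (X g (p , suc (suc q))) (g (q , suc p))
  where
  lem : ∀ a b c d → a + b + c - d ≡ c + (b + a - d)
  lem = solve-∀

-- The difference δ is constant on each antidiagonal p + q = d, and changes
-- sign under reflection of that antidiagonal, hence vanishes.
Sym-π₂ : ∀ g → Sym (π₂ g)
Sym-π₂ g p q = ℤₚ.i-j≡0⇒i≡j _ _ (2z≡0 (trans (const p q) (trans (cong (λ d → δ d 0) (ℕₚ.+-comm p q)) (sym (const q p)))))
  where
  δ : ℕ → ℕ → ℤ
  δ p q = π₂ g (p , q) - π₂ g (q , p)
  shift : ∀ p q → δ p (suc q) ≡ δ (suc p) q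
  shift p q = lem (π₂ g (suc p , q)) (g (p , suc q)) (g (q , suc p)) (π₂ g (suc q , p))
    where
    lem : ∀ a b c d → a + b - c - d ≡ a - (d + c - b)
    lem = solve-∀
  const : ∀ p q → δ p q ≡ δ (p ℕ.+ q) 0
  const p zero = cong (λ d → δ d 0) (sym (ℕₚ.+-identityʳ p))
  const p (suc q) = trans (shift p q) (trans (const (suc p) q) (cong (λ d → δ d 0) (sym (ℕₚ.+-suc p q))))
  self-neg : ∀ z → z ≡ - z → z ≡ 0ℤ
  self-neg (pos zero) _ = refl
  self-neg (pos (suc _)) ()
  self-neg (-[1+ _ ]) ()
  2z≡0 : δ p q ≡ δ q p → δ p q ≡ 0ℤ
  2z≡0 e = self-neg _ (trans e (lem (π₂ g (q , p)) (π₂ g (p , q))))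
    where
    lem : ∀ a b → a - b ≡ - (b - a)
    lem = solve-∀

-- Linear operators and branching sums

record Linear (E : (I → ℤ) → (K → ℤ)) : Set where
  field
    pres-≐ : ∀ {g h} → g ≐ h → E g ≐ E h
    pres-⊕ : ∀ g h → E (g ⊕ h) ≐ E g ⊕ E h

  pres-0 : E (λ _ → 0ℤ) ≐ λ _ → 0ℤ
  pres-0 i = ℤ+.∙-cancelˡ  (E (λ _ → 0ℤ) i) _ _
    (trans (sym (pres-⊕ _ _ i)) (sym (ℤₚ.+-identityʳ _)))

  pres-⊖ : ∀ g h → E (λ i → g i - h i) ≐ λ i → E g i - E h i
  pres-⊖ g h i = ℤ+.∙-cancelʳ  (E h i) _ _
    (trans (sym (pres-⊕ _ h i))
      (trans (pres-≐ (λ j → lem (g j) (h j)) i) (sym (lem (E g i) (E h i)))))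
    where
    lem : ∀ a b → a - b + b ≡ a
    lem = solve-∀

  -- `F` is a polynomial in two groups of variables. `E` acts on one group and `π₂` on the other,
  -- and a value of `π₂` is a finite signed sum, so the two commute.
  pres-π₂ : ∀ (F : I → Biv) p q k →
    E (λ i → π₂ (F i) (p , q)) k ≡ π₂ (λ t → E (λ i → F i t) k) (p , q)
  pres-π₂ F p zero    k = refl
  pres-π₂ F p (suc q) k =
    trans (pres-⊖ _ _ k) (cong₂ _-_ (trans (pres-⊕ _ _ k) (cong₂ _+_ (pres-π₂ F (suc p) q k) refl)) refl)


open Linear

X-linear : Linear X
X-linear = record
  { pres-≐ = λ { e (zero , v) → refl ; e (suc u , v) → e _ }
  ; pres-⊕ = λ { g h (zero , v) → refl ; g h (suc u , v) → refl } }

Y-linear : Linear Y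
Y-linear = record
  { pres-≐ = λ { e (u , zero) → refl ; e (u , suc v) → e _ }
  ; pres-⊕ = λ { g h (u , zero) → refl ; g h (u , suc v) → refl } }

XY-comm : ∀ g → X (Y g) ≐ Y (X g)
XY-comm g (zero , zero) = refl
XY-comm g (zero , suc v) = refl
XY-comm g (suc u , zero) = refl
XY-comm g (suc u , suc v) = refl

-- Horner form of Σ_{i ≤ k} Zᵏ⁻ⁱ F (l + i)
horner : ((I → ℤ) → (I → ℤ)) → (ℕ → I → ℤ) → ℕ → ℕ → I → ℤ
horner Z F l zero    = F l
horner Z F l (suc k) = Z (horner Z F l k) ⊕ F (suc k ℕ.+ l)

power : ((I → ℤ) → (I → ℤ)) → ℕ → (I → ℤ) → (I → ℤ)
power Z zero    g = g
power Z (suc k) g = Z (power Z k g)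

-- Σ_μ Z^(|λ|-|μ|) Φ μ over the μ interlacing λ
branch : ((I → ℤ) → (I → ℤ)) → Vec ℕ (suc m) → (Vec ℕ m → I → ℤ) → I → ℤ
branch Z (x ∷ [])    Φ = power Z x (Φ [])
branch Z (x ∷ y ∷ r) Φ = horner Z (λ u → branch Z (y ∷ r) (λ μ → Φ (u ∷ μ))) y (x ∸ y)

Interlaces : Vec ℕ (suc m) → Vec ℕ m → Set
Interlaces (x ∷ [])    []      = ⊤
Interlaces (x ∷ y ∷ r) (u ∷ μ) = (y ≤ u × u ≤ x) × Interlaces (y ∷ r) μ

module _ {Z : (I → ℤ) → (I → ℤ)} (Z-linear : Linear Z) where

  horner-cong : ∀ {F G} l k → (∀ i → i ≤ k → F (i ℕ.+ l) ≐ G (i ℕ.+ l)) →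
                horner Z F l k ≐ horner Z G l k
  horner-cong l zero    e = e 0 z≤n
  horner-cong l (suc k) e i = cong₂ _+_
    (pres-≐ Z-linear (horner-cong l k (λ j p → e j (ℕₚ.m≤n⇒m≤1+n p))) i) (e (suc k) ℕₚ.≤-refl i)

  power-cong : ∀ {g h} k → g ≐ h → power Z k g ≐ power Z k h
  power-cong zero    e = e
  power-cong (suc k) e = pres-≐ Z-linear (power-cong k e)

  branch-≐ : ∀ (λ' : Vec ℕ (suc m)) {Φ Ψ} → (∀ μ → Φ μ ≐ Ψ μ) → branch Z λ' Φ ≐ branch Z λ' Ψ
  branch-≐ (x ∷ [])    e = power-cong x (e [])
  branch-≐ (x ∷ y ∷ r) e = horner-cong y (x ∸ y) λ i _ → branch-≐ (y ∷ r) λ μ → e _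

  -- `Decreasing` makes the truncated difference in `branch` honest: for x < y the sum would still
  -- contain the entry y, which does not interlace.
  branch-cong : ∀ {λ' : Vec ℕ (suc m)} {Φ Ψ} → Decreasing λ' →
                (∀ μ → Interlaces λ' μ → Φ μ ≐ Ψ μ) → branch Z λ' Φ ≐ branch Z λ' Ψ
  branch-cong {λ' = x ∷ []} d e = power-cong x (e [] _)
  branch-cong {λ' = x ∷ y ∷ r} (y≤x , d) e = horner-cong y (x ∸ y) λ i i≤ →
    branch-cong d λ μ j → e _ ((ℕₚ.m≤n+m y i , ℕₚ.≤-trans (ℕₚ.+-monoˡ-≤ y i≤) (ℕₚ.≤-reflexive (ℕₚ.m∸n+n≡m y≤x))) , j)

  horner-⊕ : ∀ F G l k → horner Z (λ u → F u ⊕ G u) l k ≐ horner Z F l k ⊕ horner Z G l k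
  horner-⊕ F G l zero    i = refl
  horner-⊕ F G l (suc k) i = trans
    (cong (_+ _) (trans (pres-≐ Z-linear (horner-⊕ F G l k) i) (pres-⊕ Z-linear _ _ i)))
    (lem (Z (horner Z F l k) i) _ _ _)
    where
    lem : ∀ a b c d → a + b + (c + d) ≡ a + c + (b + d)
    lem = solve-∀

  power-⊕ : ∀ k g h → power Z k (g ⊕ h) ≐ power Z k g ⊕ power Z k h
  power-⊕ zero    g h i = refl
  power-⊕ (suc k) g h i = trans (pres-≐ Z-linear (power-⊕ k g h) i) (pres-⊕ Z-linear _ _ i)

  branch-⊕ : ∀ (λ' : Vec ℕ (suc m)) Φ Ψ →
             branch Z λ' (λ μ → Φ μ ⊕ Ψ μ) ≐ branch Z λ' Φ ⊕ branch Z λ' Ψ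
  branch-⊕ (x ∷ [])    Φ Ψ = power-⊕ x _ _
  branch-⊕ (x ∷ y ∷ r) Φ Ψ i = trans
    (horner-cong y (x ∸ y) (λ j _ → branch-⊕ (y ∷ r) _ _) i) (horner-⊕ _ _ y (x ∸ y) i)

module _ {E : (I → ℤ) → (K → ℤ)} (E-linear : Linear E)
         {Z : (I → ℤ) → (I → ℤ)} {Z′ : (K → ℤ) → (K → ℤ)} (Z′-linear : Linear Z′)
         (nat : ∀ g → E (Z g) ≐ Z′ (E g)) where

  horner-natural : ∀ F l k → E (horner Z F l k) ≐ horner Z′ (λ u → E (F u)) l k
  horner-natural F l zero    i = refl
  horner-natural F l (suc k) i =
    trans (pres-⊕ E-linear _ _ i) (cong (_+ _) (trans (nat _ i) (pres-≐ Z′-linear (horner-natural F l k) i)))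

  power-natural : ∀ k g → E (power Z k g) ≐ power Z′ k (E g)
  power-natural zero    g i = refl
  power-natural (suc k) g i = trans (nat _ i) (pres-≐ Z′-linear (power-natural k g) i)

  branch-natural : ∀ (λ' : Vec ℕ (suc m)) Φ → E (branch Z λ' Φ) ≐ branch Z′ λ' (λ μ → E (Φ μ))
  branch-natural (x ∷ [])    Φ = power-natural x (Φ [])
  branch-natural (x ∷ y ∷ r) Φ i = trans (horner-natural _ y (x ∸ y) i)
    (horner-cong Z′-linear y (x ∸ y) (λ j _ → branch-natural (y ∷ r) (λ μ → Φ (j ℕ.+ y ∷ μ))) i)

module _ (Z : (I → ℤ) → (I → ℤ)) where

  -- One Horner step: every old summand gains a factor Z, and the rows with first entry p + 1 are
  -- new.
  branch-suc : ∀ {p m₁} (r : Vec ℕ m) Φ → m₁ ≤ p →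
    branch Z (suc p ∷ m₁ ∷ r) Φ ≡ Z (branch Z (p ∷ m₁ ∷ r) Φ) ⊕ branch Z (m₁ ∷ r) (λ μ → Φ (suc p ∷ μ))
  branch-suc {p = p} {m₁} r Φ m₁≤p rewrite ℕₚ.+-∸-assoc 1 m₁≤p | ℕₚ.m∸n+n≡m m₁≤p = refl

  -- Two equal leading parts pin the entry between them.
  branch-refl : ∀ p (r : Vec ℕ m) Φ →
    branch Z (p ∷ p ∷ r) Φ ≡ branch Z (p ∷ r) (λ μ → Φ (p ∷ μ))
  branch-refl p r Φ rewrite ℕₚ.n∸n≡0 p = refl

-- Three consecutive rows of Gelfand-Tsetlin patterns

-- Sums over the middle one of three consecutive rows of Gelfand–Tsetlin
-- patterns, with φ applied to the lower row: U takes all middle rows under λ',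
-- T only those under p ∷ μ with first entry p.  By π₂-T, π₂ frees that entry.
T : ℕ → Vec ℕ (suc m) → (Vec ℕ m → Biv) → Biv
T p μ φ = branch Y μ (λ ν → branch X (p ∷ ν) φ)

U : Vec ℕ (suc (suc m)) → (Vec ℕ m → Biv) → Biv
U λ' φ = branch Y λ' (λ η → branch X η φ)

-- One Horner step in the middle row p ∷ ν, for all ν at once. In the new terms the lower row begins
-- with p + 1; its other entries interlace ν, so both rows are free again and form a `U`.
T-suc : ∀ {p m₁ m₂} {r : Vec ℕ m} φ → Decreasing (p ∷ m₁ ∷ m₂ ∷ r) →
  T (suc p) (m₁ ∷ m₂ ∷ r) φ ≐
  X (T p (m₁ ∷ m₂ ∷ r) φ) ⊕ U (m₁ ∷ m₂ ∷ r) (λ τ → φ (suc p ∷ τ))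
T-suc {p = p} {m₁} {m₂} {r} φ (m₁≤p , d) i = trans
  (branch-cong Y-linear {Φ = λ ν → branch X (suc p ∷ ν) φ} d step i)
  (trans (branch-⊕ Y-linear (m₁ ∷ m₂ ∷ r) (λ ν → X (branch X (p ∷ ν) φ)) (λ ν → branch X ν (λ τ → φ (suc p ∷ τ))) i)
         (cong₂ _+_ (sym (branch-natural X-linear Y-linear XY-comm (m₁ ∷ m₂ ∷ r) (λ ν → branch X (p ∷ ν) φ) i)) refl))
  where
  step : ∀ ν → Interlaces (m₁ ∷ m₂ ∷ r) ν →
    branch X (suc p ∷ ν) φ ≐ X (branch X (p ∷ ν) φ) ⊕ branch X ν (λ τ → φ (suc p ∷ τ))
  step (ν₁ ∷ ν) ((_ , ν₁≤m₁) , _) j = cong (λ h → h j) (branch-suc X ν φ (ℕₚ.≤-trans ν₁≤m₁ m₁≤p))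

Sym-≐ : ∀ {g h} → g ≐ h → Sym h → Sym g
Sym-≐ e s u v = trans (e _) (trans (s u v) (sym (e _)))

Sym-⊕ : ∀ {g h} → Sym g → Sym h → Sym (g ⊕ h)
Sym-⊕ s t u v = cong₂ _+_ (s u v) (t u v)

Sym-YX : ∀ {g} → Sym g → Sym (Y (X g))
Sym-YX s zero    zero    = refl
Sym-YX s zero    (suc v) = refl
Sym-YX s (suc u) zero    = refl
Sym-YX s (suc u) (suc v) = s u v

Sym-power : ∀ {g} → Sym g → ∀ k → Sym (power Y k (power X k g))
Sym-power s zero    = s
Sym-power {g} s (suc k) = Sym-≐
  (λ i → pres-≐ Y-linear (λ j → sym (power-natural X-linear Y-linear XY-comm k (power X k g) j)) i)
  (Sym-YX (Sym-power s k))

-- Induction on p - m₁. At p = m₁ the first entry is pinned anyway and `π₂` fixes the symmetric `T`.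
-- In the step, the Leibniz rule turns X T + R into Y (π₂ T) + (X T + R), which is the Horner step
-- of `U` from p to p + 1.
π₂-T-from : ∀ {m₁} {r : Vec ℕ m} φ → Sym (T m₁ (m₁ ∷ r) φ) →
  (∀ p → m₁ ≤ p → ∃ λ R → Sym R × T (suc p) (m₁ ∷ r) φ ≐ X (T p (m₁ ∷ r) φ) ⊕ R) →
  ∀ p → m₁ ≤ p → π₂ (T p (m₁ ∷ r) φ) ≐ U (p ∷ m₁ ∷ r) φ
π₂-T-from {m₁ = m₁} {r} φ base rec p m₁≤p with ℕₚ.m≤n⇒∃[o]m+o≡n m₁≤p
... | k , refl rewrite ℕₚ.+-comm m₁ k = go k
  where
  μ = m₁ ∷ r
  go : ∀ k → π₂ (T (k ℕ.+ m₁) μ φ) ≐ U (k ℕ.+ m₁ ∷ μ) φ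
  go zero (u , v) = trans (π₂-Sym base u v)
    (sym (cong (λ h → h (u , v)) (branch-refl Y m₁ r (λ η → branch X η φ))))
  go (suc k) (u , v) with rec (k ℕ.+ m₁) (ℕₚ.m≤n+m m₁ k)
  ... | R , R-sym , e = begin
    π₂ (T (suc k ℕ.+ m₁) μ φ) (u , v)         ≡⟨ π₂-cong e u v ⟩
    π₂ (X t ⊕ R) (u , v)                      ≡⟨ π₂-⊕ (X t) R u v ⟩
    π₂ (X t) (u , v) + π₂ R (u , v)           ≡⟨ cong₂ _+_ (π₂-X t u v) (π₂-Sym R-sym u v) ⟩
    X t (u , v) + Y (π₂ t) (u , v) + R (u , v) ≡⟨ lem (X t (u , v)) _ _ ⟩
    Y (π₂ t) (u , v) + (X t ⊕ R) (u , v)      ≡⟨ cong₂ _+_ (pres-≐ Y-linear (go k) (u , v)) (sym (e _)) ⟩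
    Y (U (k ℕ.+ m₁ ∷ μ) φ) (u , v) + T (suc k ℕ.+ m₁) μ φ (u , v)
      ≡⟨ sym (cong (λ h → h (u , v)) (branch-suc Y r (λ η → branch X η φ) (ℕₚ.m≤n+m m₁ k))) ⟩
    U (suc k ℕ.+ m₁ ∷ μ) φ (u , v) ∎
    where
    open ≡-Reasoning
    t = T (k ℕ.+ m₁) μ φ
    lem : ∀ a b c → a + b + c ≡ b + (a + c)
    lem = solve-∀

-- The symmetry usually proved by the Bender-Knuth involution. Here it holds because `U` is a value
-- of `π₂`. The three mutual lemmas recurse on the length of `r`: the remainder term of a step is a
-- `U` with fewer parts.
Sym-U : ∀ {p m₁} {r : Vec ℕ m} φ → (∀ τ → Sym (φ τ)) → Decreasing (p ∷ m₁ ∷ r) → Sym (U (p ∷ m₁ ∷ r) φ)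

-- Induction on m₁ - m₂. Raising m₁ by one multiplies `T` by the symmetric monomial xy and adds a
-- `U` with fewer parts. At m₁ = m₂ the leading entries of the middle and lower rows are pinned,
-- which leaves a shorter `T`.
Sym-T : ∀ {m₁} {r : Vec ℕ m} φ → (∀ τ → Sym (φ τ)) → Decreasing (m₁ ∷ r) → Sym (T m₁ (m₁ ∷ r) φ)

π₂-T : ∀ {p m₁} {r : Vec ℕ m} φ → (∀ τ → Sym (φ τ)) → Decreasing (p ∷ m₁ ∷ r) →
  π₂ (T p (m₁ ∷ r) φ) ≐ U (p ∷ m₁ ∷ r) φ

Sym-U {r = r} φ s d = Sym-≐ (λ i → sym (π₂-T {r = r} φ s d i)) (Sym-π₂ _)

Sym-T {m₁ = m₁} {[]} φ s d = Sym-power (s []) m₁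
Sym-T {m₁ = m₁} {m₂ ∷ r} φ s (m₂≤m₁ , d) with ℕₚ.m≤n⇒∃[o]m+o≡n m₂≤m₁
... | k , refl rewrite ℕₚ.+-comm m₂ k = go k
  where
  μ = m₂ ∷ r
  go : ∀ k → Sym (T (k ℕ.+ m₂) (k ℕ.+ m₂ ∷ μ) φ)
  go zero = Sym-≐
    (λ i → trans (cong (λ h → h i) (branch-refl Y m₂ r (λ ν → branch X (m₂ ∷ ν) φ)))
      (branch-cong Y-linear d (λ ν _ j → cong (λ h → h j) (branch-refl X m₂ ν φ)) i))
    (Sym-T {m₁ = m₂} {r} (λ τ → φ (m₂ ∷ τ)) (λ τ → s (m₂ ∷ τ)) d)
  go (suc k) = Sym-≐ e (Sym-⊕ (Sym-YX (go k)) (Sym-U {r = r} φ′ (λ τ → s _) (ℕₚ.m≤n+m m₂ (suc k) , d)))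
    where
    M = k ℕ.+ m₂
    m₂≤M = ℕₚ.m≤n+m m₂ k
    φ′ = λ τ → φ (suc M ∷ τ)
    open ≡-Reasoning
    e : T (suc M) (suc M ∷ μ) φ ≐ Y (X (T M (M ∷ μ) φ)) ⊕ U (suc M ∷ μ) φ′
    e i = begin
      T (suc M) (suc M ∷ μ) φ i
        ≡⟨ cong (λ h → h i) (branch-suc Y r (λ ν → branch X (suc M ∷ ν) φ) m₂≤M) ⟩
      Y (T (suc M) (M ∷ μ) φ) i + branch Y μ (λ ν → branch X (suc M ∷ suc M ∷ ν) φ) i
        ≡⟨ cong₂ _+_
             (trans (pres-≐ Y-linear (T-suc φ (ℕₚ.≤-refl , m₂≤M , d)) i) (pres-⊕ Y-linear (X (T M (M ∷ μ) φ)) _ i))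
             (branch-cong Y-linear d (λ ν _ j → cong (λ h → h j) (branch-refl X (suc M) ν φ)) i) ⟩
      Y (X (T M (M ∷ μ) φ)) i + Y (U (M ∷ μ) φ′) i + T (suc M) μ φ′ i
        ≡⟨ ℤₚ.+-assoc (Y (X (T M (M ∷ μ) φ)) i) _ _ ⟩
      Y (X (T M (M ∷ μ) φ)) i + (Y (U (M ∷ μ) φ′) i + T (suc M) μ φ′ i)
        ≡⟨ cong (Y (X (T M (M ∷ μ) φ)) i +_)
             (sym (cong (λ h → h i) (branch-suc Y r (λ η → branch X η φ′) m₂≤M))) ⟩
      Y (X (T M (M ∷ μ) φ)) i + U (suc M ∷ μ) φ′ i ∎

-- With a single part below p the middle row is p alone and the lower row is empty, so raising p
-- only multiplies by x and the remainder is 0.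
π₂-T {m₁ = m₁} {[]} φ s d = π₂-T-from {r = []} φ (Sym-T {m₁ = m₁} {[]} φ s _) (λ p _ → (λ _ → 0ℤ) , (λ _ _ → refl) ,
  λ i → trans (sym (power-natural X-linear Y-linear XY-comm m₁ (power X p (φ [])) i)) (sym (ℤₚ.+-identityʳ _))) _ (proj₁ d)
π₂-T {m₁ = m₁} {m₂ ∷ r} φ s (m₁≤p , d) = π₂-T-from {r = m₂ ∷ r} φ (Sym-T {r = m₂ ∷ r} φ s d)
  (λ p m₁≤p → U (m₁ ∷ m₂ ∷ r) (λ τ → φ (suc p ∷ τ)) , Sym-U {r = r} _ (λ τ → s _) d , T-suc φ (m₁≤p , d)) _ m₁≤p

-- Demazure operators by recursion on the position

sumℤ-++ : ∀ xs ys → sumℤ (xs ++ ys) ≡ sumℤ xs + sumℤ ys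
sumℤ-++ []       ys = sym (ℤₚ.+-identityˡ _)
sumℤ-++ (x ∷ xs) ys = trans (cong (x +_) (sumℤ-++ xs ys)) (sym (ℤₚ.+-assoc x _ _))

sumℤ-upTo : ∀ (F : ℕ → ℤ) k → sumℤ (L.map F (upTo (suc k))) ≡ sumℤ (L.map F (upTo k)) + F k
sumℤ-upTo F k = begin
  sumℤ (L.map F (upTo (suc k)))             ≡⟨ cong (λ l → sumℤ (L.map F l)) (sym (Lₚ.upTo-∷ʳ k)) ⟩
  sumℤ (L.map F (upTo k L.∷ʳ k))            ≡⟨ cong sumℤ (Lₚ.map-++ F (upTo k) L.[ k ]) ⟩
  sumℤ (L.map F (upTo k) ++ L.[ F k ])      ≡⟨ sumℤ-++ (L.map F (upTo k)) _ ⟩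
  sumℤ (L.map F (upTo k)) + (F k + 0ℤ)      ≡⟨ cong (sumℤ (L.map F (upTo k)) +_) (ℤₚ.+-identityʳ _) ⟩
  sumℤ (L.map F (upTo k)) + F k             ∎
  where open ≡-Reasoning

divided-difference : ∀ g p q → let d = suc (p ℕ.+ q) in
  sumℤ (L.map (λ j → X g (d ∸ j , j) - X g (j , d ∸ j)) (upTo (suc q))) ≡ π₂ g (p , q)
divided-difference g p zero rewrite ℕₚ.+-identityʳ p = lem (g (p , 0))
  where
  lem : ∀ a → a - 0ℤ + 0ℤ ≡ a
  lem = solve-∀
divided-difference g p (suc q) = begin
  sumℤ (L.map F (upTo (suc (suc q))))        ≡⟨ sumℤ-upTo F (suc q) ⟩
  sumℤ (L.map F (upTo (suc q))) + F (suc q)  ≡⟨ cong₂ _+_ front last ⟩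
  π₂ g (suc p , q) + (g (p , suc q) - g (q , suc p)) ≡⟨ sym (ℤₚ.+-assoc (π₂ g (suc p , q)) _ _) ⟩
  π₂ g (p , suc q) ∎
  where
  open ≡-Reasoning
  F : ℕ → ℤ
  F j = X g (suc (p ℕ.+ suc q) ∸ j , j) - X g (j , suc (p ℕ.+ suc q) ∸ j)
  -- The points (p, q + 1) and (p + 1, q) share their antidiagonal, so all summands but the last are
  -- those of the neighbour.
  front : sumℤ (L.map F (upTo (suc q))) ≡ π₂ g (suc p , q)
  front rewrite ℕₚ.+-suc p q = divided-difference g (suc p) q
  last : F (suc q) ≡ g (p , suc q) - g (q , suc p)
  last rewrite ℕₚ.+-suc p q | ℕₚ.+-∸-assoc 1 (ℕₚ.m≤n+m q p) | ℕₚ.m+n∸n≡m p q = refl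

-- A form of `π` without vector updates: fixing the exponents on either side of the two active
-- positions commutes with it definitionally or by a short induction.
demazure : Fin m → Poly (suc m) → Poly (suc m)
demazure zero    f (x ∷ y ∷ r) = π₂ (λ (u , v) → f (u ∷ v ∷ r)) (x , y)
demazure (suc i) f (x ∷ r)     = demazure i (λ c → f (x ∷ c)) r

mulX-suc : ∀ (j : Fin n) f x b → mulX (suc j) f (x ∷ b) ≡ mulX j (λ c → f (x ∷ c)) b
mulX-suc j f x b with lookup b j
... | zero  = refl
... | suc _ = refl

∂-cong : ∀ (i : Fin m) {f g} → f ≈ g → ∂ i f ≈ ∂ i g
∂-cong i e b = cong sumℤ (Lₚ.map-cong (λ j → cong₂ _-_ (e _) (e _)) (upTo (suc (lookup b (suc i)))))

π≈demazure : ∀ (i : Fin m) f → π i f ≈ demazure i f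
π≈demazure zero f (x ∷ y ∷ r) = trans
  (cong sumℤ (Lₚ.map-cong (λ j → cong₂ _-_ (shift (d ∸ j) j) (shift j (d ∸ j))) (upTo (suc y))))
  (divided-difference (λ (u , v) → f (u ∷ v ∷ r)) x y)
  where
  d = suc (x ℕ.+ y)
  shift : ∀ u v → mulX zero f (u ∷ v ∷ r) ≡ X (λ (u , v) → f (u ∷ v ∷ r)) (u , v)
  shift zero    v = refl
  shift (suc u) v = refl
π≈demazure (suc i) f (x ∷ b) = trans
  (∂-cong i (mulX-suc (inject₁ i) f x) b) (π≈demazure i (λ c → f (x ∷ c)) b)

demazure-linear : ∀ (i : Fin m) → Linear (demazure i)
demazure-linear zero = record
  { pres-≐ = λ { e (x ∷ y ∷ r) → π₂-cong (λ t → e _) x y }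
  ; pres-⊕ = λ { g h (x ∷ y ∷ r) → π₂-⊕ _ _ x y } }
demazure-linear (suc i) = record
  { pres-≐ = λ { e (x ∷ r) → pres-≐ (demazure-linear i) (λ c → e _) r }
  ; pres-⊕ = λ { g h (x ∷ r) → pres-⊕ (demazure-linear i) _ _ r } }

demazures : List (Fin m) → Poly (suc m) → Poly (suc m)
demazures []      f = f
demazures (i ∷ w) f = demazure i (demazures w f)

πword≈demazures : ∀ (w : List (Fin m)) f → πword w f ≈ demazures w f
πword≈demazures []      f b = refl
πword≈demazures (i ∷ w) f b = trans (π≈demazure i _ b) (pres-≐ (demazure-linear i) (πword≈demazures w f) b)

demazures-linear : ∀ (w : List (Fin m)) → Linear (demazures w)
demazures-linear []      = record { pres-≐ = λ e → e ; pres-⊕ = λ g h i → refl }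
demazures-linear (i ∷ w) = record
  { pres-≐ = λ e → pres-≐ (demazure-linear i) (pres-≐ (demazures-linear w) e)
  ; pres-⊕ = λ g h b → trans (pres-≐ (demazure-linear i) (pres-⊕ (demazures-linear w) g h) b)
                             (pres-⊕ (demazure-linear i) _ _ b) }

demazures-++ : ∀ (w w′ : List (Fin m)) f → demazures (w ++ w′) f ≡ demazures w (demazures w′ f)
demazures-++ []      w′ f = refl
demazures-++ (i ∷ w) w′ f = cong (demazure i) (demazures-++ w w′ f)

demazures-suc : ∀ (w : List (Fin m)) f x c →
  demazures (L.map suc w) f (x ∷ c) ≡ demazures w (λ c → f (x ∷ c)) c
demazures-suc []      f x c = refl
demazures-suc (i ∷ w) f x c = pres-≐ (demazure-linear i) (demazures-suc w f x) c

demazure-inject₁ : ∀ (i : Fin m) f b e →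
  demazure (inject₁ i) f (b ∷ʳ e) ≡ demazure i (λ c → f (c ∷ʳ e)) b
demazure-inject₁ zero    f (x ∷ y ∷ r) e = refl
demazure-inject₁ (suc i) f (x ∷ r)     e = demazure-inject₁ i _ r e

demazures-inject₁ : ∀ (w : List (Fin m)) f b e →
  demazures (L.map inject₁ w) f (b ∷ʳ e) ≡ demazures w (λ c → f (c ∷ʳ e)) b
demazures-inject₁ []      f b e = refl
demazures-inject₁ (i ∷ w) f b e = trans (demazure-inject₁ i _ b e)
  (pres-≐ (demazure-linear i) (λ c → demazures-inject₁ w f c e) b)

demazure-fromℕ : ∀ f (b : Vec ℕ m) u v →
  demazure (fromℕ m) f (b ∷ʳ u ∷ʳ v) ≡ π₂ (λ (s , t) → f (b ∷ʳ s ∷ʳ t)) (u , v)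
demazure-fromℕ f []      u v = refl
demazure-fromℕ f (x ∷ b) u v = demazure-fromℕ (λ c → f (x ∷ c)) b u v

demazure-comm : ∀ (i : Fin m) f → demazure zero (demazure (suc (suc i)) f) ≈ demazure (suc (suc i)) (demazure zero f)
demazure-comm i f (x ∷ y ∷ r) = sym (pres-π₂ (demazure-linear i) (λ c (u , v) → f (u ∷ v ∷ c)) x y r)

demazures-comm : ∀ (w : List (Fin m)) f →
  demazures (L.map suc (L.map suc w)) (demazure zero f) ≈ demazure zero (demazures (L.map suc (L.map suc w)) f)
demazures-comm []      f b = refl
demazures-comm (i ∷ w) f b = trans (pres-≐ (demazure-linear (suc (suc i))) (demazures-comm w f) b)
  (sym (demazure-comm i _ b))

-- Branching of Schur polynomials in the last variable

const₁ : ℤ → ℕ → ℤ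
const₁ z zero    = z
const₁ z (suc _) = 0ℤ

shift : (ℕ → ℤ) → ℕ → ℤ
shift g zero    = 0ℤ
shift g (suc e) = g e

shift-linear : Linear shift
shift-linear = record
  { pres-≐ = λ { e zero → refl ; e (suc _) → e _ }
  ; pres-⊕ = λ { g h zero → refl ; g h (suc _) → refl } }

-- The coefficient of the e-th power in z times the (a - b)-th power of the variable, and 0 if a <
-- b.
weighted : ℕ → ℕ → ℤ → ℕ → ℤ
weighted a b z e with a ℕ.≟ b ℕ.+ e
... | yes _ = z
... | no  _ = 0ℤ

initLast-∷ʳ : ∀ (b : Vec ℕ m) e → initLast (b ∷ʳ e) ≡ (b , e)
initLast-∷ʳ []          e = refl
initLast-∷ʳ (x ∷ [])    e = refl
initLast-∷ʳ (x ∷ y ∷ b) e rewrite initLast-∷ʳ (y ∷ b) e = refl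

-- The type of coefficient is left to be solved from its use: it mentions a
-- function local to the definition of schur.
mutual
  schur-weighted : ∀ (λ' : Vec ℕ (suc m)) b e → schur λ' (b ∷ʳ e) ≡
    sumℤ (L.map (λ μ → weighted (vsum λ') (vsum μ) (schur μ b) e) (interlacers λ'))
  schur-weighted λ' b e rewrite initLast-∷ʳ b e =
    cong sumℤ (Lₚ.map-cong (coefficient λ' b e) (interlacers λ'))

  coefficient : ∀ (λ' : Vec ℕ (suc m)) b e μ → _ ≡ weighted (vsum λ') (vsum μ) (schur μ b) e
  coefficient λ' b e μ with vsum λ' ℕ.≟ (vsum μ ℕ.+ e)
  ... | yes _ = refl
  ... | no  _ = refl

sumℤ-cong : ∀ {f g : S → ℤ} {l} → LAll.All (λ x → f x ≡ g x) l → sumℤ (L.map f l) ≡ sumℤ (L.map g l)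
sumℤ-cong []       = refl
sumℤ-cong (e ∷ es) = cong₂ _+_ e (sumℤ-cong es)

sumℤ-0 : ∀ {f : S → ℤ} {l} → LAll.All (λ x → f x ≡ 0ℤ) l → sumℤ (L.map f l) ≡ 0ℤ
sumℤ-0 []       = refl
sumℤ-0 (e ∷ es) rewrite e = trans (ℤₚ.+-identityˡ _) (sumℤ-0 es)

sumℤ-concatMap : ∀ (f : S′ → ℤ) (h : S → List S′) l →
  sumℤ (L.map f (L.concatMap h l)) ≡ sumℤ (L.map (λ x → sumℤ (L.map f (h x))) l)
sumℤ-concatMap f h []      = refl
sumℤ-concatMap f h (x ∷ l) = trans (cong sumℤ (Lₚ.map-++ f (h x) _))
  (trans (sumℤ-++ (L.map f (h x)) _) (cong (sumℤ (L.map f (h x)) +_) (sumℤ-concatMap f h l)))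

sumℤ-interlacers : ∀ {x y k} {r : Vec ℕ m} (f : Vec ℕ (suc m) → ℤ) → k ℕ.+ y ≡ x →
  sumℤ (L.map f (interlacers (x ∷ y ∷ r))) ≡
  sumℤ (L.map (λ j → sumℤ (L.map (λ μ → f (j ℕ.+ y ∷ μ)) (interlacers (y ∷ r)))) (upTo (suc k)))
sumℤ-interlacers {y = y} {k} {r} f refl = begin
  sumℤ (L.map f (interlacers (k ℕ.+ y ∷ y ∷ r)))
    ≡⟨ sumℤ-concatMap f _ (range y (k ℕ.+ y)) ⟩
  sumℤ (L.map (λ u → sumℤ (L.map f (L.map (u ∷_) l))) (range y (k ℕ.+ y)))
    ≡⟨ cong sumℤ (sym (Lₚ.map-∘ (upTo (suc (k ℕ.+ y) ∸ y)))) ⟩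
  sumℤ (L.map (λ j → sumℤ (L.map f (L.map (y ℕ.+ j ∷_) l))) (upTo (suc (k ℕ.+ y) ∸ y)))
    ≡⟨ cong (λ n → sumℤ (L.map (λ j → sumℤ (L.map f (L.map (y ℕ.+ j ∷_) l))) (upTo n))) (ℕₚ.m+n∸n≡m (suc k) y) ⟩
  sumℤ (L.map (λ j → sumℤ (L.map f (L.map (y ℕ.+ j ∷_) l))) (upTo (suc k)))
    ≡⟨ cong sumℤ (Lₚ.map-cong (λ j → cong sumℤ (trans (sym (Lₚ.map-∘ l))
         (cong (λ u → L.map (λ μ → f (u ∷ μ)) l) (ℕₚ.+-comm y j)))) (upTo (suc k))) ⟩
  sumℤ (L.map (λ j → sumℤ (L.map (λ μ → f (j ℕ.+ y ∷ μ)) l)) (upTo (suc k))) ∎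
  where
  open ≡-Reasoning
  l = interlacers (y ∷ r)

weighted-⇔ : ∀ {a b e a′ b′ e′} z → (a ≡ b ℕ.+ e → a′ ≡ b′ ℕ.+ e′) → (a′ ≡ b′ ℕ.+ e′ → a ≡ b ℕ.+ e) →
  weighted a b z e ≡ weighted a′ b′ z e′
weighted-⇔ {a} {b} {e} {a′} {b′} {e′} z to from with a ℕ.≟ b ℕ.+ e | a′ ℕ.≟ b′ ℕ.+ e′
... | yes _ | yes _ = refl
... | no  _ | no  _ = refl
... | yes p | no ¬p = contradiction (to p) ¬p
... | no ¬p | yes p = contradiction (from p) ¬p

weighted-≢ : ∀ {a b e} z → a ≢ b ℕ.+ e → weighted a b z e ≡ 0ℤ
weighted-≢ {a} {b} {e} z ¬p with a ℕ.≟ b ℕ.+ e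
... | yes p = contradiction p ¬p
... | no  _ = refl

weighted-suc : ∀ a b z e → weighted (suc a) b z (suc e) ≡ weighted a b z e
weighted-suc a b z e = weighted-⇔ {b = b} {b′ = b} z
  (λ p → ℕₚ.suc-injective (trans p (ℕₚ.+-suc b e)))
  (λ p → trans (cong suc p) (sym (ℕₚ.+-suc b e)))

weighted-+ : ∀ n a b z e → weighted (n ℕ.+ a) (n ℕ.+ b) z e ≡ weighted a b z e
weighted-+ n a b z e = weighted-⇔ {b = n ℕ.+ b} {b′ = b} z
  (λ p → ℕₚ.+-cancelˡ-≡ n _ _ (trans p (ℕₚ.+-assoc n b e)))
  (λ p → trans (cong (n ℕ.+_) p) (sym (ℕₚ.+-assoc n b e)))

power-shift : ∀ x z e → weighted (x ℕ.+ 0) 0 z e ≡ power shift x (const₁ z) e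
power-shift zero    z zero    = refl
power-shift zero    z (suc e) = refl
power-shift (suc x) z zero    = refl
power-shift (suc x) z (suc e) = trans (weighted-suc (x ℕ.+ 0) 0 z e) (power-shift x z e)

range-≤ : ∀ {lo hi} → lo ≤ hi → LAll.All (_≤ hi) (range lo hi)
range-≤ {lo} {hi} lo≤hi = LAllₚ.map⁺ (LAllₚ.applyUpTo⁺₁ _ _ λ {i} i< → ℕₚ.≤-pred
  (subst (_≤ suc hi) (cong suc (ℕₚ.+-comm i lo)) (ℕₚ.m≤o∸n⇒m+n≤o (suc i) (ℕₚ.m≤n⇒m≤1+n lo≤hi) i<)))

interlacers-vsum : ∀ (λ' : Vec ℕ (suc m)) → Decreasing λ' → LAll.All (λ μ → vsum μ ≤ vsum λ') (interlacers λ')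
interlacers-vsum (x ∷ [])    _ = z≤n ∷ []
interlacers-vsum (x ∷ y ∷ r) (y≤x , d) = LAllₚ.concat⁺ (LAllₚ.map⁺ (LAll.map
  (λ u≤x → LAllₚ.map⁺ (LAll.map (ℕₚ.+-mono-≤ u≤x) (interlacers-vsum (y ∷ r) d))) (range-≤ y≤x)))

-- Induction on x - y: raising the first part lowers the exponent left for every old row by one,
-- which is a `shift`, and the new row with first entry x contributes the top Horner term.
sum-branch : ∀ (λ' : Vec ℕ (suc m)) → Decreasing λ' → ∀ (φ : Vec ℕ m → ℤ) e →
  sumℤ (L.map (λ μ → weighted (vsum λ') (vsum μ) (φ μ) e) (interlacers λ')) ≡
  branch shift λ' (λ μ → const₁ (φ μ)) e
sum-branch (x ∷ [])    d φ e = trans (ℤₚ.+-identityʳ _) (power-shift x (φ []) e)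
sum-branch (x ∷ y ∷ r) (y≤x , d) φ e = trans
  (sumℤ-interlacers {r = r} _ (ℕₚ.m∸n+n≡m y≤x))
  (trans (cong (λ x → sumℤ (L.map (λ j → sumℤ (L.map (λ μ → weighted (x ℕ.+ vsum (y ∷ r)) (j ℕ.+ y ℕ.+ vsum μ) (φ (j ℕ.+ y ∷ μ)) e) (interlacers (y ∷ r)))) (upTo (suc k)))) (sym (ℕₚ.m∸n+n≡m y≤x)))
   (go k e))
  where
  k = x ∸ y
  l = interlacers (y ∷ r)
  inner : ℕ → ℕ → ℕ → ℤ
  inner k e j = sumℤ (L.map (λ μ → weighted (k ℕ.+ y ℕ.+ vsum (y ∷ r)) (j ℕ.+ y ℕ.+ vsum μ) (φ (j ℕ.+ y ∷ μ)) e) l)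
  F : ℕ → ℕ → ℤ
  F u = branch shift (y ∷ r) (λ μ → const₁ (φ (u ∷ μ)))
  diagonal : ∀ k e → inner k e k ≡ F (k ℕ.+ y) e
  diagonal k e = trans (sumℤ-cong (LAll.universal (λ μ → weighted-+ (k ℕ.+ y) _ (vsum μ) _ e) l))
                       (sum-branch (y ∷ r) d (λ μ → φ (k ℕ.+ y ∷ μ)) e)
  go : ∀ k e → sumℤ (L.map (inner k e) (upTo (suc k))) ≡ horner shift F y k e
  go zero    e = trans (ℤₚ.+-identityʳ _) (diagonal zero e)
  go (suc k) e = trans (sumℤ-upTo (inner (suc k) e) (suc k)) (cong₂ _+_ (below e) (diagonal (suc k) e))
    where
    below : ∀ e → sumℤ (L.map (inner (suc k) e) (upTo (suc k))) ≡ shift (horner shift F y k) e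
    -- At exponent 0 a row would need the full size of the shape, but its first entry falls short of
    -- the first part.
    below zero    = sumℤ-0 {f = inner (suc k) 0} (LAllₚ.applyUpTo⁺₁ _ (suc k) λ {j} j≤k → sumℤ-0 {f = λ μ → weighted (suc k ℕ.+ y ℕ.+ vsum (y ∷ r)) (j ℕ.+ y ℕ.+ vsum μ) (φ (j ℕ.+ y ∷ μ)) 0} (LAll.map
      (λ {μ} μ≤ → weighted-≢ {b = j ℕ.+ y ℕ.+ vsum μ} _ λ p → ℕₚ.<⇒≢ (s≤s (ℕₚ.+-mono-≤ (ℕₚ.+-monoˡ-≤ y (ℕₚ.≤-pred j≤k)) μ≤))
        (sym (trans p (ℕₚ.+-identityʳ _))))
      (interlacers-vsum (y ∷ r) d)))
    below (suc e) = trans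
      (sumℤ-cong (LAll.universal (λ j → sumℤ-cong (LAll.universal (λ μ → weighted-suc (k ℕ.+ y ℕ.+ vsum (y ∷ r)) (j ℕ.+ y ℕ.+ vsum μ) _ e) l)) (upTo (suc k))))
      (go k e)

schur-∷ʳ : ∀ (λ' : Vec ℕ (suc m)) → Decreasing λ' → ∀ b e →
  schur λ' (b ∷ʳ e) ≡ branch shift λ' (λ μ → const₁ (schur μ b)) e
schur-∷ʳ λ' d b e = trans (schur-weighted λ' b e) (sum-branch λ' d (λ μ → schur μ b) e)

module _ {E : (I → ℤ) → (K → ℤ)} (E-linear : Linear E) where

  pres-monomial : ∀ x f e k →
    E (λ i → power shift x (const₁ (f i)) e) k ≡ power shift x (const₁ (E f k)) e
  pres-monomial zero    f zero    k = refl
  pres-monomial zero    f (suc e) k = pres-0 E-linear k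
  pres-monomial (suc x) f zero    k = pres-0 E-linear k
  pres-monomial (suc x) f (suc e) k = pres-monomial x f e k

  pres-horner : ∀ (F : ℕ → I → ℕ → ℤ) l k e j →
    E (λ i → horner shift (λ u → F u i) l k e) j ≡ horner shift (λ u e → E (λ i → F u i e) j) l k e
  pres-horner F l zero    e       j = refl
  pres-horner F l (suc k) zero    j = trans (pres-⊕ E-linear _ _ j) (cong₂ _+_ (pres-0 E-linear j) refl)
  pres-horner F l (suc k) (suc e) j = trans (pres-⊕ E-linear _ _ j) (cong₂ _+_ (pres-horner F l k e j) refl)

  -- The branching variable is separate from those of `I`, on which `E` acts. This moves Demazure
  -- operators inside the expansion in the last variable.
  pres-branch : ∀ (λ' : Vec ℕ (suc m)) (F : Vec ℕ m → I → ℤ) e k →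
    E (λ i → branch shift λ' (λ μ → const₁ (F μ i)) e) k ≡ branch shift λ' (λ μ → const₁ (E (F μ) k)) e
  pres-branch (x ∷ [])    F e k = pres-monomial x (F []) e k
  pres-branch (x ∷ y ∷ r) F e k = trans
    (pres-horner (λ u i → branch shift (y ∷ r) (λ μ → const₁ (F (u ∷ μ) i))) y (x ∸ y) e k)
    (horner-cong shift-linear y (x ∸ y) (λ j _ e → pres-branch (y ∷ r) (λ μ → F (j ℕ.+ y ∷ μ)) e k) e)

-- The last two variables and the symmetry of Schur polynomials

const₂ : ℤ → Biv
const₂ z (u , v) = const₁ (const₁ z u) v

Sym-const₂ : ∀ z → Sym (const₂ z)
Sym-const₂ z zero    zero    = refl
Sym-const₂ z zero    (suc v) = refl
Sym-const₂ z (suc u) zero    = refl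
Sym-const₂ z (suc u) (suc v) = refl

-- Nested sums in one variable each become a single sum in two: `extend` regards a polynomial in the
-- first variable as one in both, and `slice` extracts the coefficient of the u-th power of the
-- first.
branch-branch : ∀ {k} (λ' : Vec ℕ (suc m)) (G : Vec ℕ m → Vec ℕ (suc k)) (z : Vec ℕ k → ℤ) u v →
  branch shift λ' (λ μ → const₁ (branch shift (G μ) (λ τ → const₁ (z τ)) u)) v ≡
  branch Y λ' (λ μ → branch X (G μ) (λ τ → const₂ (z τ))) (u , v)
branch-branch λ' G z u v = trans
  (branch-≐ shift-linear λ' (λ μ t → branch-natural extend-linear X-linear extend-shift (G μ) (λ τ → const₁ (z τ)) (u , t)) v)
  (sym (branch-natural slice-linear shift-linear slice-Y λ' (λ μ → branch X (G μ) (λ τ → const₂ (z τ))) v))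
  where
  extend : (ℕ → ℤ) → Biv
  extend h (s , t) = const₁ (h s) t
  extend-linear : Linear extend
  extend-linear = record
    { pres-≐ = λ { e (s , zero) → e s ; e (s , suc t) → refl }
    ; pres-⊕ = λ { g h (s , zero) → refl ; g h (s , suc t) → refl } }
  extend-shift : ∀ h → extend (shift h) ≐ X (extend h)
  extend-shift h (zero  , zero)  = refl
  extend-shift h (zero  , suc t) = refl
  extend-shift h (suc s , t)     = refl
  slice : Biv → ℕ → ℤ
  slice g t = g (u , t)
  slice-linear : Linear slice
  slice-linear = record { pres-≐ = λ e t → e _ ; pres-⊕ = λ g h t → refl }
  slice-Y : ∀ g → slice (Y g) ≐ shift (slice g)
  slice-Y g zero    = refl
  slice-Y g (suc t) = refl

Interlaces-Decreasing : ∀ (λ' : Vec ℕ (suc m)) {μ} → Decreasing λ' → Interlaces λ' μ → Decreasing μ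
Interlaces-Decreasing (x ∷ [])        {[]}        _ _ = _
Interlaces-Decreasing (x ∷ y ∷ [])    {u ∷ []}    _ _ = _
Interlaces-Decreasing (x ∷ y ∷ z ∷ r) {u ∷ w ∷ μ} (_ , d) ((y≤u , _) , i@((_ , w≤y) , _)) =
  ℕₚ.≤-trans w≤y y≤u , Interlaces-Decreasing (y ∷ z ∷ r) d i

-- `p ∷ ν` is itself a row under `p ∷ μ`.
Interlaces-bound : ∀ {p} (μ : Vec ℕ (suc m)) {ν} → Decreasing (p ∷ μ) → Interlaces μ ν → Decreasing (p ∷ ν)
Interlaces-bound {p = p} (x ∷ r) d@(x≤p , _) i =
  Interlaces-Decreasing (p ∷ x ∷ r) d ((x≤p , ℕₚ.≤-refl) , i)

-- Rearrangements generated from the right end, to match the branching of `schur`: `swap` is the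
-- symmetry of `U`, and `snoc` passes through one branching step.
data _∼_ : Vec ℕ n → Vec ℕ n → Set where
  swap    : ∀ (b : Vec ℕ n) u v → (b ∷ʳ u ∷ʳ v) ∼ (b ∷ʳ v ∷ʳ u)
  snoc    : ∀ {b c : Vec ℕ n} → b ∼ c → ∀ e → (b ∷ʳ e) ∼ (c ∷ʳ e)
  ∼-refl  : ∀ {b : Vec ℕ n} → b ∼ b
  ∼-trans : ∀ {b c d : Vec ℕ n} → b ∼ c → c ∼ d → b ∼ d

∷ʳ∼∷ : ∀ (b : Vec ℕ n) x → (b ∷ʳ x) ∼ (x ∷ b)
∷ʳ∼∷ {zero}  [] x = ∼-refl
∷ʳ∼∷ {suc n} b  x with V.initLast b
... | c , y , refl = ∼-trans (swap c y x) (snoc (∷ʳ∼∷ c x) y)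

reverse-∼ : ∀ (b : Vec ℕ n) → reverse b ∼ b
reverse-∼ []      = ∼-refl
reverse-∼ (x ∷ b) rewrite Vₚ.reverse-∷ x b = ∼-trans (snoc (reverse-∼ b) x) (∷ʳ∼∷ b x)

schur-∷ʳ-∷ʳ : ∀ (λ' : Vec ℕ (suc (suc m))) → Decreasing λ' → ∀ b u v →
  schur λ' (b ∷ʳ u ∷ʳ v) ≡ U λ' (λ τ → const₂ (schur τ b)) (u , v)
schur-∷ʳ-∷ʳ λ' d b u v = begin
  schur λ' (b ∷ʳ u ∷ʳ v)
    ≡⟨ schur-∷ʳ λ' d (b ∷ʳ u) v ⟩
  branch shift λ' (λ μ → const₁ (schur μ (b ∷ʳ u))) v
    ≡⟨ branch-cong shift-linear d (λ μ i t → cong (λ z → const₁ z t) (schur-∷ʳ μ (Interlaces-Decreasing λ' d i) b u)) v ⟩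
  branch shift λ' (λ μ → const₁ (branch shift μ (λ τ → const₁ (schur τ b)) u)) v
    ≡⟨ branch-branch λ' (λ μ → μ) (λ τ → schur τ b) u v ⟩
  U λ' (λ τ → const₂ (schur τ b)) (u , v) ∎
  where open ≡-Reasoning

schur-∼ : ∀ {b c : Vec ℕ n} → b ∼ c → ∀ λ' → Decreasing λ' → schur λ' b ≡ schur λ' c
schur-∼ (swap b u v) λ'@(p ∷ m₁ ∷ r) d = begin
  schur λ' (b ∷ʳ u ∷ʳ v) ≡⟨ schur-∷ʳ-∷ʳ λ' d b u v ⟩
  U λ' φ (u , v)         ≡⟨ Sym-U {r = r} φ (λ τ → Sym-const₂ (schur τ b)) d u v ⟩
  U λ' φ (v , u)         ≡⟨ sym (schur-∷ʳ-∷ʳ λ' d b v u) ⟩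
  schur λ' (b ∷ʳ v ∷ʳ u) ∎
  where
  open ≡-Reasoning
  φ = λ τ → const₂ (schur τ b)
schur-∼ (snoc {b = b} {c} b∼c e) λ' d = begin
  schur λ' (b ∷ʳ e) ≡⟨ schur-∷ʳ λ' d b e ⟩
  branch shift λ' (λ μ → const₁ (schur μ b)) e
    ≡⟨ branch-cong shift-linear d (λ μ i t → cong (λ z → const₁ z t) (schur-∼ b∼c μ (Interlaces-Decreasing λ' d i))) e ⟩
  branch shift λ' (λ μ → const₁ (schur μ c)) e
    ≡⟨ sym (schur-∷ʳ λ' d c e) ⟩
  schur λ' (c ∷ʳ e) ∎
  where open ≡-Reasoning
schur-∼ ∼-refl        λ' d = refl
schur-∼ (∼-trans p q) λ' d = trans (schur-∼ p λ' d) (schur-∼ q λ' d)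

schur-reverse : ∀ (λ' : Vec ℕ n) → Decreasing λ' → ∀ b → schur λ' (reverse b) ≡ schur λ' b
schur-reverse λ' d b = schur-∼ (reverse-∼ b) λ' d

-- Schur polynomials from chains of Demazure operators

-- x₀ᵖ f(x₁, x₂, …)
consX : ℕ → Poly m → Poly (suc m)
consX p f (b ∷ c) = power shift p (const₁ (f c)) b

consX-linear : ∀ p → Linear (consX {m} p)
consX-linear p = record
  { pres-≐ = λ { e (b ∷ c) → cong (λ z → power shift p (const₁ z) b) (e c) }
  ; pres-⊕ = λ { g h (b ∷ c) → trans
      (power-cong shift-linear p (λ { zero → refl ; (suc _) → refl }) b)
      (power-⊕ shift-linear p (const₁ (g c)) (const₁ (h c)) b) } }

demazures-consX : ∀ (w : List (Fin m)) p f → demazures (L.map suc w) (consX p f) ≈ consX p (demazures w f)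
demazures-consX w p f (b ∷ c) = trans (demazures-suc w (consX p f) b c)
  (pres-monomial (demazures-linear w) p f b c)

-- The word c-1, ..., 1, 0, whose letter 0 acts first: it carries the first entry past c others.
descent : ∀ m → ℕ → List (Fin m)
descent zero    _       = []
descent (suc m) zero    = []
descent (suc m) (suc c) = L.map suc (descent m c) ++ L.[ zero ]

descent-inject₁ : ∀ {m c} → c ≤ m → descent (suc m) c ≡ L.map inject₁ (descent m c)
descent-inject₁ {zero}  z≤n = refl
descent-inject₁ {suc m} z≤n = refl
descent-inject₁ {suc m} {suc c} (s≤s c≤m) = begin
  L.map suc (descent (suc m) c) ++ L.[ zero ]
    ≡⟨ cong (λ w → L.map suc w ++ L.[ zero ]) (descent-inject₁ c≤m) ⟩
  L.map suc (L.map inject₁ (descent m c)) ++ L.[ zero ]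
    ≡⟨ cong (_++ L.[ zero ]) (trans (sym (Lₚ.map-∘ (descent m c))) (Lₚ.map-∘ (descent m c))) ⟩
  L.map inject₁ (L.map suc (descent m c)) ++ L.[ zero ]
    ≡⟨ sym (Lₚ.map-++ inject₁ (L.map suc (descent m c)) _) ⟩
  L.map inject₁ (descent (suc m) (suc c)) ∎
  where open ≡-Reasoning

descent-full : ∀ m → descent (suc m) (suc m) ≡ fromℕ m ∷ L.map inject₁ (descent m m)
descent-full zero    = refl
descent-full (suc m) = trans (cong (λ w → L.map suc w ++ L.[ zero ]) (descent-full m))
  (cong (fromℕ (suc m) ∷_) (trans (cong (λ w → w ++ L.[ zero ]) (trans (sym (Lₚ.map-∘ (descent m m))) (Lₚ.map-∘ (descent m m))))
    (sym (Lₚ.map-++ inject₁ (L.map suc (descent m m)) _))))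

Ties : ℕ → ℕ → Vec ℕ n → Set
Ties zero    p μ       = ⊤
Ties (suc t) p []      = ⊥
Ties (suc t) p (x ∷ μ) = x ≡ p × Ties t p μ

-- Each pair of equal neighbours pins the entry between them, so passing to the next row costs
-- exactly one guaranteed tie.
Ties-Interlaces : ∀ t {p} (μ : Vec ℕ (suc m)) {ν} → Decreasing (p ∷ μ) → Ties (suc t) p μ → Interlaces μ ν → Ties t p ν
Ties-Interlaces zero    μ d ties i = _
Ties-Interlaces (suc t) (x ∷ y ∷ r) {u ∷ ν} (x≤p , d) (refl , refl , ties) ((y≤u , u≤x) , i) =
  ℕₚ.≤-antisym u≤x y≤u , Ties-Interlaces t (y ∷ r) d (refl , ties) i

-- With a tie, the chain avoids the last variable, and the first entry of the next row is forced to
-- be p: branching alone suffices. Without one, there is one more letter, and `π₂-T` frees that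
-- entry. `t` is only a lower bound on the ties, so rows ν that happen to begin with p cause no
-- extra case.
Demazure-chain : ∀ t p (μ : Vec ℕ m) → Decreasing (p ∷ μ) → Ties t p μ →
  demazures (descent m (m ∸ t)) (consX p (schur μ)) ≈ schur (p ∷ μ)

Demazure-slice : ∀ t p (μ : Vec ℕ (suc m)) → Decreasing (p ∷ μ) →
  (∀ ν → Interlaces μ ν → Ties t p ν) → ∀ c e →
  demazures (L.map inject₁ (descent m (m ∸ t))) (consX p (schur μ)) (c ∷ʳ e) ≡
  branch shift μ (λ ν → const₁ (schur (p ∷ ν) c)) e
Demazure-slice {m} t p μ d ties c e = begin
  demazures (L.map inject₁ w) (consX p (schur μ)) (c ∷ʳ e)
    ≡⟨ demazures-inject₁ w _ c e ⟩
  demazures w (λ c → consX p (schur μ) (c ∷ʳ e)) c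
    ≡⟨ pres-≐ (demazures-linear w) (λ { (x ∷ c) → trans
         (cong (λ z → power shift p (const₁ z) x) (schur-∷ʳ μ (tail d) c e))
         (pres-branch (consX-linear p) μ schur e (x ∷ c)) }) c ⟩
  demazures w (λ c → branch shift μ (λ ν → const₁ (consX p (schur ν) c)) e) c
    ≡⟨ pres-branch (demazures-linear w) μ (λ ν → consX p (schur ν)) e c ⟩
  branch shift μ (λ ν → const₁ (demazures w (consX p (schur ν)) c)) e
    ≡⟨ branch-cong shift-linear (tail d) (λ ν i t → cong (λ z → const₁ z t)
         (Demazure-chain _ p ν (Interlaces-bound μ d i) (ties ν i) c)) e ⟩
  branch shift μ (λ ν → const₁ (schur (p ∷ ν) c)) e ∎
  where
  open ≡-Reasoning
  w = descent m (m ∸ t)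
  tail : ∀ {p} {μ : Vec ℕ (suc m)} → Decreasing (p ∷ μ) → Decreasing μ
  tail {μ = x ∷ r} (_ , d) = d

Demazure-chain {zero} t p [] d ties (b ∷ []) = sym (schur-∷ʳ (p ∷ []) _ [] b)
Demazure-chain {suc m} t p μ d ties b with V.initLast b
Demazure-chain {suc m} (suc t) p μ@(y ∷ r) d@(_ , d′) ties@(refl , _) _ | c , e , refl = begin
  demazures (descent (suc m) (m ∸ t)) (consX p (schur μ)) (c ∷ʳ e)
    ≡⟨ cong (λ w → demazures w (consX p (schur μ)) (c ∷ʳ e)) (descent-inject₁ (ℕₚ.m∸n≤m m t)) ⟩
  demazures (L.map inject₁ (descent m (m ∸ t))) (consX p (schur μ)) (c ∷ʳ e)
    ≡⟨ Demazure-slice t p μ d (λ ν → Ties-Interlaces t μ d ties) c e ⟩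
  branch shift μ (λ ν → const₁ (schur (p ∷ ν) c)) e
    ≡⟨ sym (cong (λ h → h e) (branch-refl shift p r (λ η → const₁ (schur η c)))) ⟩
  branch shift (p ∷ μ) (λ η → const₁ (schur η c)) e
    ≡⟨ sym (schur-∷ʳ (p ∷ μ) d c e) ⟩
  schur (p ∷ μ) (c ∷ʳ e) ∎
  where open ≡-Reasoning
Demazure-chain {suc m} zero p μ@(m₁ ∷ r) d ties _ | c′ , v , refl with V.initLast c′
... | c , u , refl = begin
  demazures (descent (suc m) (suc m)) f (c ∷ʳ u ∷ʳ v)
    ≡⟨ cong (λ w → demazures w f (c ∷ʳ u ∷ʳ v)) (descent-full m) ⟩
  demazure (fromℕ m) (demazures (L.map inject₁ (descent m m)) f) (c ∷ʳ u ∷ʳ v)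
    ≡⟨ demazure-fromℕ _ c u v ⟩
  π₂ (λ (s , t) → demazures (L.map inject₁ (descent m m)) f (c ∷ʳ s ∷ʳ t)) (u , v)
    ≡⟨ π₂-cong slice u v ⟩
  π₂ (T p μ φ) (u , v)
    ≡⟨ π₂-T {r = r} φ (λ τ → Sym-const₂ (schur τ c)) d (u , v) ⟩
  U (p ∷ μ) φ (u , v)
    ≡⟨ sym (schur-∷ʳ-∷ʳ (p ∷ μ) d c u v) ⟩
  schur (p ∷ μ) (c ∷ʳ u ∷ʳ v) ∎
  where
  open ≡-Reasoning
  f = consX p (schur μ)
  φ = λ τ → const₂ (schur τ c)
  slice : (λ (s , t) → demazures (L.map inject₁ (descent m m)) f (c ∷ʳ s ∷ʳ t)) ≐ T p μ φ
  slice (s , t) = begin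
    demazures (L.map inject₁ (descent m m)) f (c ∷ʳ s ∷ʳ t)
      ≡⟨ Demazure-slice 0 p μ d (λ _ _ → _) (c ∷ʳ s) t ⟩
    branch shift μ (λ ν → const₁ (schur (p ∷ ν) (c ∷ʳ s))) t
      ≡⟨ branch-cong shift-linear (proj₂ d) (λ ν i t → cong (λ z → const₁ z t)
           (schur-∷ʳ (p ∷ ν) (Interlaces-bound μ d i) c s)) t ⟩
    branch shift μ (λ ν → const₁ (branch shift (p ∷ ν) (λ τ → const₁ (schur τ c)) s)) t
      ≡⟨ branch-branch μ (p ∷_) (λ τ → schur τ c) s t ⟩
    T p μ φ (s , t) ∎

-- Monomials and the words of increasing vectors

power-shift-refl : ∀ p z → power shift p (const₁ z) p ≡ z
power-shift-refl zero    z = refl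
power-shift-refl (suc p) z = power-shift-refl p z

power-shift-≢ : ∀ {p b} z → p ≢ b → power shift p (const₁ z) b ≡ 0ℤ
power-shift-≢ {zero}  {zero}  z p≢b = contradiction refl p≢b
power-shift-≢ {zero}  {suc b} z p≢b = refl
power-shift-≢ {suc p} {zero}  z p≢b = refl
power-shift-≢ {suc p} {suc b} z p≢b = power-shift-≢ z (p≢b ∘ cong suc)

mono-refl : ∀ (c : Vec ℕ n) → mono c c ≡ 1ℤ
mono-refl c with Vₚ.≡-dec ℕ._≟_ c c
... | yes _   = refl
... | no  c≢c = contradiction refl c≢c

mono-≢ : ∀ {c d : Vec ℕ n} → c ≢ d → mono c d ≡ 0ℤ
mono-≢ {c = c} {d} c≢d with Vₚ.≡-dec ℕ._≟_ c d
... | yes c≡d = contradiction c≡d c≢d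
... | no  _   = refl

mono-∷ : ∀ p (c : Vec ℕ n) → mono (p ∷ c) ≈ consX p (mono c)
mono-∷ p c (b ∷ d) = by-cases (p ℕ.≟ b) (Vₚ.≡-dec ℕ._≟_ c d)
  where
  by-cases : Dec (p ≡ b) → Dec (c ≡ d) → mono (p ∷ c) (b ∷ d) ≡ consX p (mono c) (b ∷ d)
  by-cases (no p≢b)   _          = trans (mono-≢ (p≢b ∘ Vₚ.∷-injectiveˡ)) (sym (power-shift-≢ (mono c d) p≢b))
  by-cases (yes refl) (yes refl) = trans (mono-refl (p ∷ c)) (sym (trans (power-shift-refl p _) (mono-refl c)))
  by-cases (yes refl) (no c≢d)   = trans (mono-≢ (c≢d ∘ Vₚ.∷-injectiveʳ)) (sym (trans (power-shift-refl p _) (mono-≢ c≢d)))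

-- The letters 0, 1, ..., c-1, which `word` selects by a filter, in a form fit for recursion.
ascent : ∀ m → ℕ → List (Fin m)
ascent zero    _       = []
ascent (suc m) zero    = []
ascent (suc m) (suc c) = zero ∷ L.map suc (ascent m c)

initial : ℕ → List (Fin n) → List (Fin n)
initial c = L.filter (λ j → toℕ j <? c)

initial-suc : ∀ c (l : List (Fin n)) → initial (suc c) (L.map suc l) ≡ L.map suc (initial c l)
initial-suc c []      = refl
initial-suc c (j ∷ l) with does (toℕ j <? c)
... | true  = cong (suc j ∷_) (initial-suc c l)
... | false = initial-suc c l

initial-0 : ∀ (l : List (Fin n)) → initial 0 l ≡ []
initial-0 []      = refl
initial-0 (j ∷ l) = initial-0 l

initial-allFin : ∀ m c → initial c (toList (allFin m)) ≡ ascent m c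
initial-allFin zero    c    = refl
initial-allFin (suc m) zero = initial-0 (toList (allFin (suc m)))
initial-allFin (suc m) (suc c) = cong (zero ∷_) (begin
  initial (suc c) (toList (V.tabulate (suc {m})))
    ≡⟨ cong (initial (suc c) ∘ toList) (Vₚ.tabulate-∘ suc id) ⟩
  initial (suc c) (toList (V.map suc (allFin m)))
    ≡⟨ cong (initial (suc c)) (Vₚ.toList-map suc (allFin m)) ⟩
  initial (suc c) (L.map suc (toList (allFin m)))
    ≡⟨ initial-suc c (toList (allFin m)) ⟩
  L.map suc (initial c (toList (allFin m)))
    ≡⟨ cong (L.map suc) (initial-allFin m c) ⟩
  L.map suc (ascent m c) ∎)
  where open ≡-Reasoning

word-∷ : ∀ x (a : Vec ℕ (suc m)) → word (x ∷ a) ≡ L.map suc (word a) ++ ascent (suc m) (countGt x a)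
word-∷ {m} x a@(_ ∷ _) = cong (L.map suc (word a) ++_) (initial-allFin (suc m) (countGt x a))

countLt : ℕ → Vec ℕ n → ℕ
countLt p [] = 0
countLt p (x ∷ a) with x <? p
... | yes _ = suc (countLt p a)
... | no  _ = countLt p a

countLt-∷ʳ : ∀ p (a : Vec ℕ n) x → countLt p (a ∷ʳ x) ≡ countLt p (x ∷ a)
countLt-∷ʳ p []      x = refl
countLt-∷ʳ p (y ∷ a) x with x <? p | countLt-∷ʳ p a x
... | yes _ | e with y <? p
...   | yes _ = cong suc e
...   | no  _ = e
countLt-∷ʳ p (y ∷ a) x | no _ | e with y <? p
...   | yes _ = cong suc e
...   | no  _ = e

countLt-reverse : ∀ p (a : Vec ℕ n) → countLt p (reverse a) ≡ countLt p a
countLt-reverse p []      = refl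
countLt-reverse p (x ∷ a) rewrite Vₚ.reverse-∷ x a | countLt-∷ʳ p (reverse a) x with x <? p
... | yes _ = cong suc (countLt-reverse p a)
... | no  _ = countLt-reverse p a

countLt-≤ : ∀ p (a : Vec ℕ n) → countLt p a ≤ n
countLt-≤ p []      = z≤n
countLt-≤ p (x ∷ a) with x <? p
... | yes _ = s≤s (countLt-≤ p a)
... | no  _ = ℕₚ.m≤n⇒m≤1+n (countLt-≤ p a)

countLt-all : ∀ {p} {a : Vec ℕ n} → All (_< p) a → countLt p a ≡ n
countLt-all []      = refl
countLt-all {p = p} {x ∷ a} (q ∷ qs) with x <? p
... | yes _  = cong suc (countLt-all qs)
... | no  ¬q = contradiction q ¬q

countLt-none : ∀ {p} {a : Vec ℕ n} → All (p ≤_) a → countLt p a ≡ 0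
countLt-none []      = refl
countLt-none {p = p} {x ∷ a} (q ∷ qs) with x <? p
... | yes x<p = contradiction q (ℕₚ.<⇒≱ x<p)
... | no  _   = countLt-none qs

countGt-none : ∀ {p} {a : Vec ℕ n} → All (_≤ p) a → countGt p a ≡ 0
countGt-none []      = refl
countGt-none {p = p} {x ∷ a} (q ∷ qs) with p <? x
... | yes p<x = contradiction q (ℕₚ.<⇒≱ p<x)
... | no  _   = countGt-none qs

countGt-∷ʳ : ∀ x (a : Vec ℕ n) p → countGt x (a ∷ʳ p) ≡ countGt x (p ∷ a)
countGt-∷ʳ x []      p = refl
countGt-∷ʳ x (y ∷ a) p with x <? p | countGt-∷ʳ x a p
... | yes _ | e with x <? y
...   | yes _ = cong suc e
...   | no  _ = e
countGt-∷ʳ x (y ∷ a) p | no _ | e with x <? y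
...   | yes _ = cong suc e
...   | no  _ = e

Increasing : Vec ℕ n → Set
Increasing []      = ⊤
Increasing (x ∷ a) = All (x ≤_) a × Increasing a

All-∷ʳ : ∀ {P : ℕ → Set} {a : Vec ℕ n} {x} → All P a → P x → All P (a ∷ʳ x)
All-∷ʳ []       px = px ∷ []
All-∷ʳ (q ∷ qs) px = q ∷ All-∷ʳ qs px

All-reverse : ∀ {P : ℕ → Set} {a : Vec ℕ n} → All P a → All P (reverse a)
All-reverse {a = []}    [] = []
All-reverse {a = x ∷ a} (p ∷ ps) rewrite Vₚ.reverse-∷ x a = All-∷ʳ (All-reverse ps) p

Increasing-∷ʳ : ∀ {a : Vec ℕ n} {p} → Increasing a → All (_≤ p) a → Increasing (a ∷ʳ p)
Increasing-∷ʳ {a = []}    _ _ = [] , _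
Increasing-∷ʳ {a = x ∷ a} (x≤ , i) (x≤p ∷ ≤p) = All-∷ʳ x≤ x≤p , Increasing-∷ʳ i ≤p

Decreasing-head : ∀ {p} (μ : Vec ℕ n) → Decreasing (p ∷ μ) → All (_≤ p) μ
Decreasing-head []      _ = []
Decreasing-head (x ∷ μ) (x≤p , d) = x≤p ∷ All.map (λ y≤x → ℕₚ.≤-trans y≤x x≤p) (Decreasing-head μ d)

Decreasing-tail : ∀ {p} (μ : Vec ℕ n) → Decreasing (p ∷ μ) → Decreasing μ
Decreasing-tail []      _ = _
Decreasing-tail (x ∷ μ) (_ , d) = d

Increasing-reverse : ∀ (μ : Vec ℕ n) → Decreasing μ → Increasing (reverse μ)
Increasing-reverse []      _ = _
Increasing-reverse (p ∷ μ) d rewrite Vₚ.reverse-∷ p μ =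
  Increasing-∷ʳ (Increasing-reverse μ (Decreasing-tail μ d)) (All-reverse (Decreasing-head μ d))

demazures-suc-cong : ∀ (w w′ : List (Fin m)) → (∀ f → demazures w f ≈ demazures w′ f) →
  ∀ f → demazures (L.map suc w) f ≈ demazures (L.map suc w′) f
demazures-suc-cong w w′ e f (x ∷ c) =
  trans (demazures-suc w f x c) (trans (e _ c) (sym (demazures-suc w′ f x c)))

-- word splits off the first entry of a vector; for increasing vectors, moving
-- letters past distant ones lets it split off the last entry instead.
word-∷ʳ : ∀ (a : Vec ℕ (suc m)) p → Increasing a → All (_≤ p) a → ∀ f →
  demazures (word (a ∷ʳ p)) f ≈ demazures (descent (suc m) (countLt p a) ++ L.map suc (word a)) f
word-∷ʳ (x ∷ []) p i ≤p f b rewrite word-∷ x (p ∷ []) with x <? p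
... | yes _ = refl
... | no  _ = refl
word-∷ʳ {suc m} (x ∷ a@(_ ∷ _)) p (x≤ , i) (x≤p ∷ ≤p) f b
  rewrite word-∷ x (a ∷ʳ p) | word-∷ x a | countGt-∷ʳ x a p with x <? p
-- Here x also passes p, so its ascent begins with an additional letter 0. The letters of `W` are at
-- least 2; letter 0 moves to their left and completes the descent.
... | yes x<p = begin
  demazures (L.map suc (word (a ∷ʳ p)) ++ zero ∷ L.map suc w) f b
    ≡⟨ cong (λ g → g b) (demazures-++ (L.map suc (word (a ∷ʳ p))) _ f) ⟩
  demazures (L.map suc (word (a ∷ʳ p))) (demazure zero h) b
    ≡⟨ demazures-suc-cong (word (a ∷ʳ p)) (D ++ L.map suc (word a)) (word-∷ʳ a p i ≤p) _ b ⟩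
  demazures (L.map suc (D ++ L.map suc (word a))) (demazure zero h) b
    ≡⟨ cong (λ w → demazures w (demazure zero h) b) (Lₚ.map-++ suc D _) ⟩
  demazures (L.map suc D ++ W) (demazure zero h) b
    ≡⟨ cong (λ g → g b) (demazures-++ (L.map suc D) _ _) ⟩
  demazures (L.map suc D) (demazures W (demazure zero h)) b
    ≡⟨ pres-≐ (demazures-linear (L.map suc D)) (demazures-comm (word a) h) b ⟩
  demazures (L.map suc D) (demazure zero (demazures W h)) b
    ≡⟨ sym (cong (λ g → demazures (L.map suc D) (demazure zero g) b) (demazures-++ W _ f)) ⟩
  demazures (L.map suc D) (demazure zero (demazures (W ++ L.map suc w) f)) b
    ≡⟨ sym (cong (λ g → g b) (demazures-++ (L.map suc D) _ _)) ⟩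
  demazures (L.map suc D ++ zero ∷ (W ++ L.map suc w)) f b
    ≡⟨ cong (λ w → demazures w f b) (sym (Lₚ.++-assoc (L.map suc D) L.[ zero ] _)) ⟩
  demazures ((L.map suc D ++ L.[ zero ]) ++ (W ++ L.map suc w)) f b
    ≡⟨ cong (λ w → demazures ((L.map suc D ++ L.[ zero ]) ++ w) f b) (sym (Lₚ.map-++ suc (L.map suc (word a)) w)) ⟩
  demazures ((L.map suc D ++ L.[ zero ]) ++ L.map suc (L.map suc (word a) ++ w)) f b ∎
  where
  open ≡-Reasoning
  w = ascent (suc m) (countGt x a)
  D = descent (suc m) (countLt p a)
  W = L.map suc (L.map suc (word a))
  h = demazures (L.map suc w) f
-- Now x = p, hence all entries equal p and both counts vanish.
... | no x≮p rewrite countGt-none (All.map (λ y≤p → ℕₚ.≤-trans y≤p (ℕₚ.≮⇒≥ x≮p)) ≤p)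
                   | countLt-none (All.map (ℕₚ.≤-trans (ℕₚ.≮⇒≥ x≮p)) x≤)
                   | Lₚ.++-identityʳ (L.map {B = Fin (suc (suc m))} suc (word (a ∷ʳ p)))
                   | Lₚ.++-identityʳ (L.map {B = Fin (suc m)} suc (word a)) =
  trans (demazures-suc-cong (word (a ∷ʳ p)) (descent (suc m) (countLt p a) ++ L.map suc (word a)) (word-∷ʳ a p i ≤p) f b)
        (cong (λ c → demazures (L.map suc (descent (suc m) c ++ L.map suc (word a))) f b)
              (countLt-none (All.map (ℕₚ.≤-trans (ℕₚ.≮⇒≥ x≮p)) x≤)))

-- The parts of μ that are not below p equal p, and they come first.
Ties-countLt : ∀ p (μ : Vec ℕ n) → Decreasing (p ∷ μ) → Ties (n ∸ countLt p μ) p μ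
Ties-countLt p [] d = _
Ties-countLt {suc n} p (x ∷ μ) d@(x≤p , d′) with x <? p
... | yes x<p rewrite countLt-all (All.map (λ y≤x → ℕₚ.≤-<-trans y≤x x<p) (Decreasing-head μ d′)) | ℕₚ.n∸n≡0 n = _
... | no  x≮p with refl ← ℕₚ.≤-antisym x≤p (ℕₚ.≮⇒≥ x≮p)
  rewrite ℕₚ.+-∸-assoc 1 (countLt-≤ p μ) = refl , Ties-countLt p μ d′

demazures-reverse : ∀ (λ' : Vec ℕ (suc m)) → Decreasing λ' →
  demazures (word (reverse λ')) (mono λ') ≈ schur λ'
demazures-reverse (p ∷ []) d b@(c ∷ []) = trans (mono-∷ p [] b)
  (Demazure-chain 0 p [] d _ b)
demazures-reverse {suc m} (p ∷ μ@(_ ∷ _)) d b rewrite Vₚ.reverse-∷ p μ = begin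
  demazures (word (reverse μ ∷ʳ p)) (mono (p ∷ μ)) b
    ≡⟨ word-∷ʳ (reverse μ) p (Increasing-reverse μ (Decreasing-tail μ d)) (All-reverse (Decreasing-head μ d)) _ b ⟩
  demazures (descent (suc m) (countLt p (reverse μ)) ++ W) (mono (p ∷ μ)) b
    ≡⟨ cong₂ (λ c f → demazures (descent (suc m) c ++ W) f b) c≡ refl ⟩
  demazures (D ++ W) (mono (p ∷ μ)) b
    ≡⟨ cong (λ g → g b) (demazures-++ D _ _) ⟩
  demazures D (demazures W (mono (p ∷ μ))) b
    ≡⟨ pres-≐ (demazures-linear D) (pres-≐ (demazures-linear W) (mono-∷ p μ)) b ⟩
  demazures D (demazures W (consX p (mono μ))) b
    ≡⟨ pres-≐ (demazures-linear D) (demazures-consX (word (reverse μ)) p (mono μ)) b ⟩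
  demazures D (consX p (demazures (word (reverse μ)) (mono μ))) b
    ≡⟨ pres-≐ (demazures-linear D) (pres-≐ (consX-linear p) (demazures-reverse μ (Decreasing-tail μ d))) b ⟩
  demazures D (consX p (schur μ)) b
    ≡⟨ Demazure-chain (suc m ∸ countLt p μ) p μ d (Ties-countLt p μ d) b ⟩
  schur (p ∷ μ) b ∎
  where
  open ≡-Reasoning
  W = L.map suc (word (reverse μ))
  D = descent (suc m) (suc m ∸ (suc m ∸ countLt p μ))
  c≡ : countLt p (reverse μ) ≡ suc m ∸ (suc m ∸ countLt p μ)
  c≡ = trans (countLt-reverse p μ) (sym (ℕₚ.m∸[m∸n]≡n (countLt-≤ p μ)))

-- Sorting, and the keys of increasing vectors

insert-max : ∀ {p} (a : Vec ℕ n) → All (_≤ p) a → insert p a ≡ p ∷ a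
insert-max []      _ = refl
insert-max {p = p} (x ∷ a) (x≤p ∷ _) with p <? x
... | yes p<x = contradiction x≤p (ℕₚ.<⇒≱ p<x)
... | no  _   = refl

insert-∷ : ∀ {x p} {a : Vec ℕ n} → x ≤ p → All (_≤ p) a → insert x (p ∷ a) ≡ p ∷ insert x a
insert-∷ {x = x} {p} {a} x≤p ≤p with x <? p
... | yes _   = refl
... | no  x≮p with refl ← ℕₚ.≤-antisym x≤p (ℕₚ.≮⇒≥ x≮p) = cong (p ∷_) (sym (insert-max a ≤p))

insert-All : ∀ {P : ℕ → Set} {x} {a : Vec ℕ n} → P x → All P a → All P (insert x a)
insert-All {a = []} px [] = px ∷ []
insert-All {x = x} {y ∷ a} px (py ∷ ps) with x <? y
... | yes _ = py ∷ insert-All px ps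
... | no  _ = px ∷ py ∷ ps

sort-All : ∀ {P : ℕ → Set} {a : Vec ℕ n} → All P a → All P (sort a)
sort-All []       = []
sort-All (p ∷ ps) = insert-All p (sort-All ps)

sort-∷ʳ : ∀ {p} {a : Vec ℕ n} → All (_≤ p) a → sort (a ∷ʳ p) ≡ p ∷ sort a
sort-∷ʳ [] = refl
sort-∷ʳ {a = x ∷ a} (x≤p ∷ ≤p) = trans (cong (insert x) (sort-∷ʳ ≤p)) (insert-∷ x≤p (sort-All ≤p))

sort-reverse : ∀ (λ' : Vec ℕ n) → Decreasing λ' → sort (reverse λ') ≡ λ'
sort-reverse []      d = refl
sort-reverse (p ∷ μ) d rewrite Vₚ.reverse-∷ p μ =
  trans (sort-∷ʳ (All-reverse (Decreasing-head μ d))) (cong (p ∷_) (sort-reverse μ (Decreasing-tail μ d)))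

κ-reverse : ∀ (λ' : Vec ℕ n) → Decreasing λ' → κ (reverse λ') ≈ schur λ'
κ-reverse []         d [] = refl
κ-reverse λ'@(_ ∷ _) d b rewrite sort-reverse λ' d =
  trans (πword≈demazures (word (reverse λ')) (mono λ') b) (demazures-reverse λ' d b)

-- Dominance and the leading coefficient

π₂-vanishes : ∀ g p q → (∀ u v → u ℕ.+ v ≡ p ℕ.+ q → u ≤ q ⊎ v ≤ q → g (u , v) ≡ 0ℤ) → π₂ g (p , q) ≡ 0ℤ
π₂-vanishes g p zero    z = z p 0 refl (inj₂ z≤n)
π₂-vanishes g p (suc q) z
  rewrite π₂-vanishes g (suc p) q (λ u v e → λ
            { (inj₁ u≤q) → z u v (trans e (sym (ℕₚ.+-suc p q))) (inj₁ (ℕₚ.m≤n⇒m≤1+n u≤q))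
            ; (inj₂ v≤q) → z u v (trans e (sym (ℕₚ.+-suc p q))) (inj₂ (ℕₚ.m≤n⇒m≤1+n v≤q)) })
        | z p (suc q) refl (inj₂ ℕₚ.≤-refl)
        | z q (suc p) (trans (ℕₚ.+-comm q (suc p)) (sym (ℕₚ.+-suc p q))) (inj₁ (ℕₚ.n≤1+n q)) = refl

-- In the sum defining `π₂ g (p , q)` every term other than g (p , q) is taken at a point of the
-- antidiagonal with a coordinate below q.
π₂-extremal : ∀ g p q → (∀ u v → u ℕ.+ v ≡ p ℕ.+ q → u < q ⊎ v < q → g (u , v) ≡ 0ℤ) → π₂ g (p , q) ≡ g (p , q)
π₂-extremal g p zero    z = refl
π₂-extremal g p (suc q) z
  rewrite π₂-vanishes g (suc p) q (λ u v e → λ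
            { (inj₁ u≤q) → z u v (trans e (sym (ℕₚ.+-suc p q))) (inj₁ (s≤s u≤q))
            ; (inj₂ v≤q) → z u v (trans e (sym (ℕₚ.+-suc p q))) (inj₂ (s≤s v≤q)) })
        | z q (suc p) (trans (ℕₚ.+-comm q (suc p)) (sym (ℕₚ.+-suc p q))) (inj₁ ℕₚ.≤-refl)
  = trans (ℤₚ.+-identityʳ _) (ℤₚ.+-identityˡ _)

-- For vectors of equal sum, comparing these values at every t is dominance of the sorted vectors
-- (Hardy-Littlewood-Pólya).
excess : ℕ → Vec ℕ n → ℕ
excess t []      = 0
excess t (x ∷ c) = (x ∸ t) ℕ.+ excess t c

∸-superadditive : ∀ t d x → (d ∸ t) ℕ.+ (x ∸ t) ≤ (x ℕ.+ d) ∸ t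
∸-superadditive t d x with ℕₚ.≤-total d t
... | inj₁ d≤t rewrite ℕₚ.m≤n⇒m∸n≡0 d≤t = ℕₚ.∸-monoˡ-≤ t (ℕₚ.m≤m+n x d)
... | inj₂ t≤d = begin
  (d ∸ t) ℕ.+ (x ∸ t) ≤⟨ ℕₚ.+-monoʳ-≤ (d ∸ t) (ℕₚ.m∸n≤m x t) ⟩
  (d ∸ t) ℕ.+ x       ≡⟨ ℕₚ.+-comm (d ∸ t) x ⟩
  x ℕ.+ (d ∸ t)       ≡⟨ sym (ℕₚ.+-∸-assoc x t≤d) ⟩
  (x ℕ.+ d) ∸ t       ∎
  where open ℕₚ.≤-Reasoning

∸-convex : ∀ t d {u x} → u ≤ x → ((u ℕ.+ d) ∸ t) ℕ.+ (x ∸ t) ≤ (u ∸ t) ℕ.+ ((x ℕ.+ d) ∸ t)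
∸-convex zero    d {u} {x} _ = ℕₚ.≤-reflexive (trans (ℕₚ.+-assoc u d x) (cong (u ℕ.+_) (ℕₚ.+-comm d x)))
∸-convex (suc t) d {zero} {x} _ = ∸-superadditive (suc t) d x
∸-convex (suc t) d {suc u} {suc x} (s≤s u≤x) = ∸-convex t d u≤x

-- The pair (u, v) arises from (y, x) by moving both numbers apart by d, which cannot decrease the
-- sum of a convex function.
spread : ∀ t {x y u v} → y ≤ x → u ℕ.+ v ≡ x ℕ.+ y → u ≤ y → (x ∸ t) ℕ.+ (y ∸ t) ≤ (u ∸ t) ℕ.+ (v ∸ t)
spread t {x} {y} {u} {v} y≤x e u≤y with ℕₚ.m≤n⇒∃[o]m+o≡n u≤y
... | d , refl = begin
  (x ∸ t) ℕ.+ ((u ℕ.+ d) ∸ t) ≡⟨ ℕₚ.+-comm (x ∸ t) _ ⟩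
  ((u ℕ.+ d) ∸ t) ℕ.+ (x ∸ t) ≤⟨ ∸-convex t d (ℕₚ.≤-trans u≤y y≤x) ⟩
  (u ∸ t) ℕ.+ ((x ℕ.+ d) ∸ t) ≡⟨ cong (λ w → (u ∸ t) ℕ.+ (w ∸ t)) (sym v≡) ⟩
  (u ∸ t) ℕ.+ (v ∸ t)         ∎
  where
  open ℕₚ.≤-Reasoning
  v≡ : v ≡ x ℕ.+ d
  v≡ = ℕₚ.+-cancelˡ-≡ u _ _ (trans e (trans (sym (ℕₚ.+-assoc x u d))
         (trans (cong (ℕ._+ d) (ℕₚ.+-comm x u)) (ℕₚ.+-assoc u x d))))

spread-⊎ : ∀ t {x y u v} → y ≤ x → u ℕ.+ v ≡ x ℕ.+ y → u ≤ y ⊎ v ≤ y → (x ∸ t) ℕ.+ (y ∸ t) ≤ (u ∸ t) ℕ.+ (v ∸ t)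
spread-⊎ t y≤x e (inj₁ u≤y) = spread t y≤x e u≤y
spread-⊎ t {u = u} {v} y≤x e (inj₂ v≤y) = ℕₚ.≤-trans
  (spread t y≤x (trans (ℕₚ.+-comm v u) e) v≤y) (ℕₚ.≤-reflexive (ℕₚ.+-comm (v ∸ t) (u ∸ t)))

-- The offset k accounts for the variables before the first one of f.
demazure-excess : ∀ (i : Fin m) f t N k →
  (∀ c → N < k ℕ.+ excess t c → f c ≡ 0ℤ) → ∀ c → N < k ℕ.+ excess t c → demazure i f c ≡ 0ℤ
demazure-excess zero f t N k z (x ∷ y ∷ r) N< with ℕₚ.≤-total y x
-- With the smaller exponent second, all terms of `π₂` lie at points spread at least as far, so they
-- exceed N as well. The other case is reduced to this one by the symmetry of `π₂`.
... | inj₁ y≤x = π₂-vanishes _ x y λ u v e s → z (u ∷ v ∷ r) (outer u v (spread-⊎ t y≤x e s))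
  where
  outer : ∀ u v → (x ∸ t) ℕ.+ (y ∸ t) ≤ (u ∸ t) ℕ.+ (v ∸ t) → N < k ℕ.+ excess t (u ∷ v ∷ r)
  outer u v le = ℕₚ.<-≤-trans N< (ℕₚ.+-monoʳ-≤ k (subst₂ _≤_
    (ℕₚ.+-assoc (x ∸ t) (y ∸ t) _) (ℕₚ.+-assoc (u ∸ t) (v ∸ t) _) (ℕₚ.+-monoˡ-≤ (excess t r) le)))
... | inj₂ x≤y = trans (Sym-π₂ _ x y) (π₂-vanishes _ y x λ u v e s → z (u ∷ v ∷ r) (outer u v (spread-⊎ t x≤y e s)))
  where
  outer : ∀ u v → (y ∸ t) ℕ.+ (x ∸ t) ≤ (u ∸ t) ℕ.+ (v ∸ t) → N < k ℕ.+ excess t (u ∷ v ∷ r)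
  outer u v le = ℕₚ.<-≤-trans N< (ℕₚ.+-monoʳ-≤ k (subst₂ _≤_
    (trans (cong (ℕ._+ excess t r) (ℕₚ.+-comm (y ∸ t) (x ∸ t))) (ℕₚ.+-assoc (x ∸ t) (y ∸ t) _))
    (ℕₚ.+-assoc (u ∸ t) (v ∸ t) _) (ℕₚ.+-monoˡ-≤ (excess t r) le)))
demazure-excess (suc i) f t N k z (x ∷ r) N< =
  demazure-excess i (λ c → f (x ∷ c)) t N (k ℕ.+ (x ∸ t))
    (λ c N< → z (x ∷ c) (subst (N <_) (ℕₚ.+-assoc k (x ∸ t) _) N<)) r
    (subst (N <_) (sym (ℕₚ.+-assoc k (x ∸ t) _)) N<)

Bounded : Vec ℕ n → Poly n → Set
Bounded λ' f = ∀ t c → excess t λ' < excess t c → f c ≡ 0ℤ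

demazures-Bounded : ∀ (w : List (Fin m)) λ' {f} → Bounded λ' f → Bounded λ' (demazures w f)
demazures-Bounded []      λ' z = z
demazures-Bounded (i ∷ w) λ' z t = demazure-excess i _ t _ 0 (demazures-Bounded w λ' z t)

-- Any other term has a coordinate below q, hence its partner above p, and the threshold t = p shows
-- that it violates the bound.
demazure-top : ∀ (i : Fin m) {f} λ' → Decreasing λ' → Bounded λ' f → demazure i f λ' ≡ f λ'
demazure-top zero {f} (p ∷ q ∷ r) (q≤p , d) z = π₂-extremal _ p q λ
  { u v e (inj₁ u<q) → z p (u ∷ v ∷ r) (above u v (ℕₚ.<-≤-trans (beyond u v e u<q) (ℕₚ.m≤n+m (v ∸ p) (u ∸ p))))
  ; u v e (inj₂ v<q) → z p (u ∷ v ∷ r) (above u v (ℕₚ.<-≤-trans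
      (beyond v u (trans (ℕₚ.+-comm v u) e) v<q) (ℕₚ.m≤m+n (u ∸ p) (v ∸ p)))) }
  where
  beyond : ∀ u v → u ℕ.+ v ≡ p ℕ.+ q → u < q → 0 < v ∸ p
  beyond u v e u<q = ℕₚ.m<n⇒0<n∸m (ℕₚ.≰⇒> λ v≤p → ℕₚ.<⇒≢ (ℕₚ.+-mono-<-≤ u<q v≤p) (trans e (ℕₚ.+-comm p q)))
  above : ∀ u v → 0 < (u ∸ p) ℕ.+ (v ∸ p) → excess p (p ∷ q ∷ r) < excess p (u ∷ v ∷ r)
  above u v 0< rewrite ℕₚ.n∸n≡0 p | ℕₚ.m≤n⇒m∸n≡0 q≤p =
    subst (excess p r <_) (ℕₚ.+-assoc (u ∸ p) (v ∸ p) _) (ℕₚ.+-monoˡ-< (excess p r) 0<)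
demazure-top (suc i) (x ∷ r) d z =
  demazure-top i r (Decreasing-tail r d) (λ t c lt → z t (x ∷ c) (ℕₚ.+-monoʳ-< (x ∸ t) lt))

demazures-top : ∀ (w : List (Fin m)) {f} λ' → Decreasing λ' → Bounded λ' f → demazures w f λ' ≡ f λ'
demazures-top []      λ' d z = refl
demazures-top (i ∷ w) λ' d z = trans (demazure-top i λ' d (demazures-Bounded w λ' z)) (demazures-top w λ' d z)

mono-Bounded : ∀ (λ' : Vec ℕ n) → Bounded λ' (mono λ')
mono-Bounded λ' t c lt = mono-≢ λ { refl → ℕₚ.<-irrefl refl lt }

insert-Decreasing : ∀ x (a : Vec ℕ n) → Decreasing a → Decreasing (insert x a)
insert-Decreasing x []      d = _
insert-Decreasing x (y ∷ a) d with x <? y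
... | no x≮y  = ℕₚ.≮⇒≥ x≮y , d
... | yes x<y = cons (insert x a) (insert-All (ℕₚ.<⇒≤ x<y) (Decreasing-head a d))
                  (insert-Decreasing x a (Decreasing-tail a d))
  where
  cons : ∀ {y} (c : Vec ℕ (suc n)) → All (_≤ y) c → Decreasing c → Decreasing (y ∷ c)
  cons (_ ∷ _) (z≤y ∷ _) d = z≤y , d

sort-Decreasing : ∀ (a : Vec ℕ n) → Decreasing (sort a)
sort-Decreasing []      = _
sort-Decreasing (x ∷ a) = insert-Decreasing x (sort a) (sort-Decreasing a)

excess-insert : ∀ t x (a : Vec ℕ n) → excess t (insert x a) ≡ excess t (x ∷ a)
excess-insert t x [] = refl
excess-insert t x (y ∷ a) with x <? y
... | yes _ = trans (cong ((y ∸ t) ℕ.+_) (excess-insert t x a)) (x∙yz≈y∙xz (y ∸ t) (x ∸ t) (excess t a))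
... | no  _ = refl

excess-sort : ∀ t (a : Vec ℕ n) → excess t (sort a) ≡ excess t a
excess-sort t []      = refl
excess-sort t (x ∷ a) = trans (excess-insert t x (sort a)) (cong ((x ∸ t) ℕ.+_) (excess-sort t a))

excess-∷ʳ : ∀ t (a : Vec ℕ n) x → excess t (a ∷ʳ x) ≡ excess t a ℕ.+ (x ∸ t)
excess-∷ʳ t []      x = ℕₚ.+-identityʳ _
excess-∷ʳ t (y ∷ a) x = trans (cong ((y ∸ t) ℕ.+_) (excess-∷ʳ t a x)) (sym (ℕₚ.+-assoc (y ∸ t) _ _))

excess-reverse : ∀ t (a : Vec ℕ n) → excess t (reverse a) ≡ excess t a
excess-reverse t []      = refl
excess-reverse t (x ∷ a) rewrite Vₚ.reverse-∷ x a | excess-∷ʳ t (reverse a) x | excess-reverse t a =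
  ℕₚ.+-comm (excess t a) _

κ-Bounded : ∀ (a : Vec ℕ n) → Bounded (sort a) (κ a)
κ-Bounded []        = mono-Bounded []
κ-Bounded a@(_ ∷ _) t c lt = trans (πword≈demazures (word a) _ c)
  (demazures-Bounded (word a) (sort a) (mono-Bounded (sort a)) t c lt)

κ-top : ∀ (a : Vec ℕ n) → κ a (sort a) ≡ 1ℤ
κ-top []        = refl
κ-top a@(_ ∷ _) = trans (πword≈demazures (word a) _ (sort a)) (trans
  (demazures-top (word a) (sort a) (sort-Decreasing a) (mono-Bounded (sort a))) (mono-refl (sort a)))

-- The lexicographic minimum of the support

module _ {P l} (l≤P : l ≤ P) (h : ℕ → ℤ) (h-vanishes : ∀ v → v < l → h v ≡ 0ℤ) where

  -- The polynomial x^P h(y), in which both exponents are at least l. Symmetry of `π₂` gives access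
  -- to its image at the lowest power of x.
  corner : Biv
  corner (u , v) = power shift P (const₁ (h v)) u

  corner-vanishes : ∀ u v → u < l ⊎ v < l → corner (u , v) ≡ 0ℤ
  corner-vanishes u v (inj₁ u<l) = power-shift-≢ (h v) (ℕₚ.<⇒≢ (ℕₚ.<-≤-trans u<l l≤P) ∘ sym)
  corner-vanishes u v (inj₂ v<l) rewrite h-vanishes v v<l with P ℕ.≟ u
  ... | yes refl = power-shift-refl P 0ℤ
  ... | no  P≢u  = power-shift-≢ 0ℤ P≢u

  π₂-below : ∀ p q → p < l → π₂ corner (p , q) ≡ 0ℤ
  π₂-below p q p<l = trans (Sym-π₂ corner p q) (π₂-vanishes corner q p λ
    { u v _ (inj₁ u≤p) → corner-vanishes u v (inj₁ (ℕₚ.≤-<-trans u≤p p<l))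
    ; u v _ (inj₂ v≤p) → corner-vanishes u v (inj₂ (ℕₚ.≤-<-trans v≤p p<l)) })

  π₂-lowest : ∀ q → π₂ corner (l , q) ≡ corner (q , l)
  π₂-lowest q = trans (Sym-π₂ corner l q) (π₂-extremal corner q l λ u v _ → corner-vanishes u v)

-- Induction on s. For x < y, the outermost letter acts on the y-th power of the first variable
-- times a polynomial whose lowest slice, at exponent x, is known; `π₂-lowest` exchanges these two
-- exponents and so puts x in front.
ascent-slice : ∀ x (s : Vec ℕ n) → Decreasing s → let G = demazures (ascent n (countGt x s)) (mono (insert x s)) in
  (∀ j c → j < x → G (j ∷ c) ≡ 0ℤ) × (∀ c → G (x ∷ c) ≡ mono s c)
ascent-slice x [] d =
  (λ j c j<x → trans (mono-∷ x [] (j ∷ c)) (power-shift-≢ _ (ℕₚ.<⇒≢ j<x ∘ sym))) ,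
  (λ c → trans (mono-∷ x [] (x ∷ c)) (power-shift-refl x _))
ascent-slice {suc n} x (y ∷ s) d with x <? y
... | yes x<y = (λ { j (e ∷ c) j<x → trans (slice j e c) (π₂-below (ℕₚ.<⇒≤ x<y) (h c) (h0 c) j e j<x) })
              , (λ { (e ∷ c) → trans (slice x e c) (trans (π₂-lowest (ℕₚ.<⇒≤ x<y) (h c) (h0 c) e)
                     (trans (cong (λ z → power shift y (const₁ z) e) (proj₂ ih c)) (sym (mono-∷ y s (e ∷ c))))) })
  where
  A = ascent n (countGt x s)
  ih = ascent-slice x s (Decreasing-tail s d)
  h : Vec ℕ n → ℕ → ℤ
  h c v = demazures A (mono (insert x s)) (v ∷ c)
  h0 : ∀ c v → v < x → h c v ≡ 0ℤ
  h0 c v = proj₁ ih v c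
  slice : ∀ j e c → demazure zero (demazures (L.map suc A) (mono (y ∷ insert x s))) (j ∷ e ∷ c) ≡
    π₂ (λ (u , v) → power shift y (const₁ (h c v)) u) (j , e)
  slice j e c = π₂-cong (λ (u , v) → trans
    (pres-≐ (demazures-linear (L.map suc A)) (mono-∷ y (insert x s)) (u ∷ v ∷ c))
    (demazures-consX A y (mono (insert x s)) (u ∷ v ∷ c))) j e
... | no x≮y rewrite countGt-none {p = x} (All.map (λ z≤y → ℕₚ.≤-trans z≤y (ℕₚ.≮⇒≥ x≮y)) (Decreasing-head s d)) =
  (λ j c j<x → trans (mono-∷ x (y ∷ s) (j ∷ c)) (power-shift-≢ _ (ℕₚ.<⇒≢ j<x ∘ sym))) ,
  (λ c → trans (mono-∷ x (y ∷ s) (x ∷ c)) (power-shift-refl x _))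

countGt-insert : ∀ x y (a : Vec ℕ n) → countGt x (insert y a) ≡ countGt x (y ∷ a)
countGt-insert x y [] = refl
countGt-insert x y (z ∷ a) with y <? z
... | no  _ = refl
... | yes _ with x <? y | countGt-insert x y a
...   | yes _ | e with x <? z
...     | yes _ = cong suc e
...     | no  _ = e
countGt-insert x y (z ∷ a) | yes _ | no _ | e with x <? z
...     | yes _ = cong suc e
...     | no  _ = e

countGt-sort : ∀ x (a : Vec ℕ n) → countGt x (sort a) ≡ countGt x a
countGt-sort x []      = refl
countGt-sort x (y ∷ a) with countGt-insert x y (sort a) | countGt-sort x a
... | e | e′ with x <? y
...   | yes _ = trans e (cong suc e′)
...   | no  _ = trans e e′

κ-∷ : ∀ x (a : Vec ℕ (suc m)) j c → κ (x ∷ a) (j ∷ c) ≡ demazures (word a)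
  (λ c → demazures (ascent (suc m) (countGt x (sort a))) (mono (insert x (sort a))) (j ∷ c)) c
κ-∷ {m} x a@(_ ∷ _) j c = begin
  κ (x ∷ a) (j ∷ c)
    ≡⟨ πword≈demazures (word (x ∷ a)) _ (j ∷ c) ⟩
  demazures (word (x ∷ a)) M (j ∷ c)
    ≡⟨ cong (λ w → demazures w M (j ∷ c)) (word-∷ x a) ⟩
  demazures (L.map suc (word a) ++ ascent (suc m) (countGt x a)) M (j ∷ c)
    ≡⟨ cong (λ k → demazures (L.map suc (word a) ++ ascent (suc m) k) M (j ∷ c)) (sym (countGt-sort x a)) ⟩
  demazures (L.map suc (word a) ++ A) M (j ∷ c)
    ≡⟨ cong (λ g → g (j ∷ c)) (demazures-++ (L.map suc (word a)) A M) ⟩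
  demazures (L.map suc (word a)) (demazures A M) (j ∷ c)
    ≡⟨ demazures-suc (word a) (demazures A M) j c ⟩
  demazures (word a) (λ c → demazures A M (j ∷ c)) c ∎
  where
  open ≡-Reasoning
  M = mono (insert x (sort a))
  A = ascent (suc m) (countGt x (sort a))

κ-below : ∀ {x j} (a : Vec ℕ n) c → j < x → κ (x ∷ a) (j ∷ c) ≡ 0ℤ
κ-below {x = x} {j} []        c j<x = proj₁ (ascent-slice x [] _) j c j<x
κ-below {x = x} {j} a@(_ ∷ _) c j<x = trans (κ-∷ x a j c) (trans
  (pres-≐ (demazures-linear (word a)) (λ c → proj₁ (ascent-slice x (sort a) (sort-Decreasing a)) j c j<x) c)
  (pres-0 (demazures-linear (word a)) c))

-- With `κ-below` this reads off the lexicographic minimum of the support one entry at a time.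
κ-lowest : ∀ x (a : Vec ℕ n) c → κ (x ∷ a) (x ∷ c) ≡ κ a c
κ-lowest x []        c = proj₂ (ascent-slice x [] _) c
κ-lowest x a@(_ ∷ _) c = trans (κ-∷ x a x c) (trans
  (pres-≐ (demazures-linear (word a)) (proj₂ (ascent-slice x (sort a) (sort-Decreasing a))) c)
  (sym (πword≈demazures (word a) (mono (sort a)) c)))

-- The sum of the entries never exceeds excess t c + n t, and equality means that all entries are at
-- least t. Equal excesses therefore force equal minima.
excess-≥ : ∀ {t} {c : Vec ℕ n} → All (t ≤_) c → excess t c ℕ.+ n ℕ.* t ≡ excess 0 c
excess-≥ []  = refl
excess-≥ {suc n} {t} {x ∷ c} (t≤x ∷ t≤) = begin
  (x ∸ t) ℕ.+ excess t c ℕ.+ (t ℕ.+ n ℕ.* t)   ≡⟨ interchange (x ∸ t) (excess t c) t (n ℕ.* t) ⟩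
  ((x ∸ t) ℕ.+ t) ℕ.+ (excess t c ℕ.+ n ℕ.* t) ≡⟨ cong₂ ℕ._+_ (ℕₚ.m∸n+n≡m t≤x) (excess-≥ t≤) ⟩
  x ℕ.+ excess 0 c                             ∎
  where open ≡-Reasoning

excess-bound : ∀ t (c : Vec ℕ n) → excess 0 c ≤ excess t c ℕ.+ n ℕ.* t
excess-bound t [] = z≤n
excess-bound {suc n} t (x ∷ c) = ℕₚ.≤-trans
  (ℕₚ.+-mono-≤ (subst (x ≤_) (ℕₚ.+-comm t (x ∸ t)) (ℕₚ.m≤n+m∸n x t)) (excess-bound t c))
  (ℕₚ.≤-reflexive (sym (interchange (x ∸ t) (excess t c) t (n ℕ.* t))))

excess-strict : ∀ {t x} (c : Vec ℕ n) → x < t → excess 0 (x ∷ c) < excess t (x ∷ c) ℕ.+ suc n ℕ.* t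
excess-strict {n} {t} {x} c x<t = ℕₚ.<-≤-trans
  (ℕₚ.+-mono-<-≤ (ℕₚ.<-≤-trans x<t (ℕₚ.m≤n+m t (x ∸ t))) (excess-bound t c))
  (ℕₚ.≤-reflexive (sym (interchange (x ∸ t) (excess t c) t (n ℕ.* t))))

-- An increasing vector is lexicographically smallest among its
-- rearrangements, while a is lexicographically smallest in the support of κ a.
κ-increasing : ∀ (a c : Vec ℕ n) → Increasing c → (∀ t → excess t a ≡ excess t c) → κ a c ≢ 0ℤ → c ≡ a
κ-increasing []      []      _ _ _ = refl
κ-increasing {suc n} (x ∷ a) (y ∷ c) (y≤ , i) e κ≢0 with ℕₚ.<-cmp y x
... | tri< y<x _ _  = contradiction (κ-below a c y<x) κ≢0
... | tri≈ _ refl _ = cong (x ∷_) (κ-increasing a c i (λ t → ℕₚ.+-cancelˡ-≡ (x ∸ t) _ _ (e t))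
                        (κ≢0 ∘ trans (κ-lowest x a c)))
-- y bounds all entries of y ∷ c from below but not x, so the thresholds 0 and y tell the two
-- vectors apart.
... | tri> _ _ x<y  = contradiction (begin-strict
  excess 0 (x ∷ a)                   <⟨ excess-strict a x<y ⟩
  excess y (x ∷ a) ℕ.+ suc n ℕ.* y   ≡⟨ cong (ℕ._+ suc n ℕ.* y) (e y) ⟩
  excess y (y ∷ c) ℕ.+ suc n ℕ.* y   ≡⟨ excess-≥ (ℕₚ.≤-refl ∷ y≤) ⟩
  excess 0 (y ∷ c)                   ≡⟨ sym (e 0) ⟩
  excess 0 (x ∷ a)                   ∎) (ℕₚ.<-irrefl refl)
  where open ℕₚ.≤-Reasoning

-- Comparison of keys and Young keys

1≢0 : ∀ {z} → z ≡ 1ℤ → z ≢ 0ℤ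
1≢0 refl ()

support-≤ : ∀ {a : Vec ℕ n} {c} → κ a c ≢ 0ℤ → ∀ t → excess t c ≤ excess t (sort a)
support-≤ {a = a} κ≢0 t = ℕₚ.≮⇒≥ λ lt → κ≢0 (κ-Bounded a t _ lt)

κ≈κ̂⇒reverse : ∀ (a b : Vec ℕ n) → κ a ≈ κ̂ b → a ≡ reverse (sort (reverse b))
κ≈κ̂⇒reverse a b e = sym (κ-increasing a (reverse ν) (Increasing-reverse ν (sort-Decreasing b′))
  (λ t → trans (sym (excess-sort t a)) (trans (ℕₚ.≤-antisym (below t) (above t)) (sym (excess-reverse t ν))))
  κ≢0)
  where
  b′ = reverse b
  ν = sort b′
  -- Reversing the variables turns the dominant exponent ν of `κ b′` into the increasing vector
  -- `reverse ν`.
  κ≢0 : κ a (reverse ν) ≢ 0ℤ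
  κ≢0 = 1≢0 (trans (e (reverse ν)) (trans (cong (κ b′) (Vₚ.reverse-involutive ν)) (κ-top b′)))
  below : ∀ t → excess t (sort a) ≤ excess t ν
  below t = subst (_≤ excess t ν) (excess-reverse t (sort a))
    (support-≤ {a = b′} (1≢0 (trans (sym (e (sort a))) (κ-top a))) t)
  above : ∀ t → excess t ν ≤ excess t (sort a)
  above t = subst (_≤ excess t (sort a)) (excess-reverse t ν) (support-≤ {a = a} κ≢0 t)

mainTheorem6 : (n : ℕ) (f : Poly n) →
    (((∃ λ (a : Vec ℕ n) → f ≈ κ a) × (∃ λ (b : Vec ℕ n) → f ≈ κ̂ b)) →
    ∃ λ (μ : Vec ℕ n) → Decreasing μ × f ≈ schur μ)
    × ((∃ λ (μ : Vec ℕ n) → Decreasing μ × f ≈ schur μ) →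
    (∃ λ (a : Vec ℕ n) → f ≈ κ a) × (∃ λ (b : Vec ℕ n) → f ≈ κ̂ b))
mainTheorem6 n f = to , from
  where
  to : (∃ λ a → f ≈ κ a) × (∃ λ b → f ≈ κ̂ b) → ∃ λ μ → Decreasing μ × f ≈ schur μ
  to ((a , f≈κ) , (b , f≈κ̂)) = ν , ν-Decreasing , λ c →
    trans (f≈κ c) (trans (cong (λ a → κ a c) a≡) (κ-reverse ν ν-Decreasing c))
    where
    ν = sort (reverse b)
    ν-Decreasing = sort-Decreasing (reverse b)
    a≡ = κ≈κ̂⇒reverse a b (λ c → trans (sym (f≈κ c)) (f≈κ̂ c))
  from : (∃ λ μ → Decreasing μ × f ≈ schur μ) → (∃ λ a → f ≈ κ a) × (∃ λ b → f ≈ κ̂ b)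
  from (μ , d , f≈s) =
    (reverse μ , λ c → trans (f≈s c) (sym (κ-reverse μ d c))) ,
    -- `κ̂ μ` is the key of `reverse μ` in reversed variables, and symmetry undoes the reversal.
    (μ , λ c → trans (f≈s c) (trans (sym (schur-reverse μ d c)) (sym (κ-reverse μ d (reverse c)))))
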